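{- If a d.c.e. real in $(0,1)$ is neither left-c.e. nor right-c.e., then it is fully d.c.e. speedable.
   Context: Conventions: "real" means a real number in the open interval $(0,1)$. An approximation of a real $\alpha$ is a sequence $\{a_s\}_{s\in\omega}$ of rational numbers in $[0,1]$ converging to $\alpha$. It is computable if $a_s$ can be computed from $s$. A computable approximation is left-c.e. if it is nondecreasing, right-c.e. if it is nonincreasing, and d.c.e. if it has bounded variation, i.e. $\sum_{s}|a_s-a_{s+1}|<\infty$. A real is left-c.e. (right-c.e., d.c.e.) if it has a left-c.e. (right-c.e., d.c.e.) approximation. A computable order is a computable function $f:\mathbb N\to\mathbb N$ that is nondecreasing and unbounded. Let $\{a_s\}_{s\in\omega}$ be a computable approximation of $\alpha$ and let $\rho\in[0,1)$ be rational. The approximation is $\rho$-speedable if either $\alpha$ is rational, or $\alpha$ is irrational and there is a computable order $f$ with $$\liminf_{s\to\infty}\left|\frac{\alpha-a_{f(s)}}{\alpha-a_s}\right|\le\rho .$$ It is speedable if it is $\rho$-speedable for some $\rho\in[0,1)$. A real is fully d.c.e. speedable if it is d.c.e. and all of its d.c.e. approximations are speedable. -}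

module Defs where

open import Data.Empty using (⊥-elim)
open import Data.Fin.Base using (Fin)
open import Data.Integer.Base as ℤ using (ℤ)
open import Data.Nat.Base as ℕ using (ℕ; zero; suc)
import Data.Nat.Properties as ℕ
open import Data.Product.Base using (Σ-syntax; ∃-syntax; _×_; _,_)
open import Data.Rational.Base as ℚ using (ℚ; 0ℚ; 1ℚ; ½)
import Data.Rational.Properties as ℚ
open import Data.Rational.Solver using (module +-*-Solver)
open import Data.Sum.Base using (_⊎_; inj₁; inj₂)
open import Data.Vec.Base using (Vec; []; _∷_; lookup)
open import Data.Vec.Relation.Binary.Pointwise.Inductive using (Pointwise)
open import Relation.Binary.PropositionalEquality
open import Relation.Nullary using (¬_; yes; no)

------------------------------------------------------------------------
-- Computable functions: the partial recursive functions, presented by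
-- codes with a big-step evaluation relation.

data Code : ℕ → Set where
  zer  : ∀ {n} → Code n
  succ : Code 1
  proj : ∀ {n} → Fin n → Code n
  comp : ∀ {m n} → Code m → Vec (Code n) m → Code n
  prec : ∀ {n} → Code n → Code (suc (suc n)) → Code (suc n)
  mini : ∀ {n} → Code (suc n) → Code n

infix 4 _[_]⇓_

data _[_]⇓_ : ∀ {n} → Code n → Vec ℕ n → ℕ → Set where
  zer⇓   : ∀ {n} {xs : Vec ℕ n} → zer [ xs ]⇓ 0
  succ⇓  : ∀ {x} → succ [ x ∷ [] ]⇓ suc x
  proj⇓  : ∀ {n} {i : Fin n} {xs} → proj i [ xs ]⇓ lookup xs i
  comp⇓  : ∀ {m n} {c : Code m} {ds : Vec (Code n) m} {xs ys z} →
           Pointwise (λ d y → d [ xs ]⇓ y) ds ys →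
           c [ ys ]⇓ z →
           comp c ds [ xs ]⇓ z
  prec⇓0 : ∀ {n} {c : Code n} {d xs y} →
           c [ xs ]⇓ y →
           prec c d [ 0 ∷ xs ]⇓ y
  prec⇓s : ∀ {n} {c : Code n} {d k xs y z} →
           prec c d [ k ∷ xs ]⇓ y →
           d [ k ∷ y ∷ xs ]⇓ z →
           prec c d [ suc k ∷ xs ]⇓ z
  -- `mini c` searches for the least zero in the first argument; `c` must
  -- converge at every smaller argument.
  mini⇓  : ∀ {n} {c : Code (suc n)} {xs y} →
           (∀ {k} → k ℕ.< y → ∃[ v ] c [ k ∷ xs ]⇓ suc v) →
           c [ y ∷ xs ]⇓ 0 →
           mini c [ xs ]⇓ y

Computable : (ℕ → ℕ) → Set
Computable f = Σ[ c ∈ Code 1 ] ∀ n → c [ n ∷ [] ]⇓ f n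

-- Numerator (as a difference of naturals) and denominator are computable;
-- the fraction need not be in lowest terms.
Computableℚ : (ℕ → ℚ) → Set
Computableℚ a =
  Σ[ p ∈ (ℕ → ℕ) ] Σ[ q ∈ (ℕ → ℕ) ] Σ[ r ∈ (ℕ → ℕ) ]
    Computable p × Computable q × Computable r ×
    (∀ s → a s ≡ (p s ℤ.⊖ q s) ℚ./ suc (r s))

record ComputableOrder (f : ℕ → ℕ) : Set where
  field
    computable    : Computable f
    nondecreasing : ∀ {m n} → m ℕ.≤ n → f m ℕ.≤ f n
    unbounded     : ∀ k → ∃[ n ] k ℕ.≤ f n

------------------------------------------------------------------------
-- Real numbers: Cauchy sequences of rationals, compared by _≃_, _<_, _≤_.

dist : ℚ → ℚ → ℚ
dist p q = ℚ.∣ p ℚ.- q ∣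

Cauchy : (ℕ → ℚ) → Set
Cauchy x = ∀ ε → 0ℚ ℚ.< ε →
  ∃[ N ] ∀ {m n} → N ℕ.≤ m → N ℕ.≤ n → dist (x m) (x n) ℚ.< ε

record ℝ : Set where
  constructor mkℝ
  field
    seq    : ℕ → ℚ
    cauchy : Cauchy seq

open ℝ public

infix 4 _≃_ _<_ _≤_ _#_

_≃_ : ℝ → ℝ → Set
x ≃ y = ∀ ε → 0ℚ ℚ.< ε → ∃[ N ] ∀ {n} → N ℕ.≤ n → dist (seq x n) (seq y n) ℚ.< ε

_<_ : ℝ → ℝ → Set
x < y = Σ[ ε ∈ ℚ ] 0ℚ ℚ.< ε × (∃[ N ] ∀ {n} → N ℕ.≤ n → seq x n ℚ.+ ε ℚ.≤ seq y n)

_≤_ : ℝ → ℝ → Set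
x ≤ y = ¬ (y < x)

-- Apartness, the positive form of inequality; it agrees with ¬ (x ≃ y)
-- under excluded middle.
_#_ : ℝ → ℝ → Set
x # y = x < y ⊎ y < x

module CauchyEstimates where

  half : ∀ {ε} → 0ℚ ℚ.< ε → 0ℚ ℚ.< ½ ℚ.* ε
  half {ε} 0<ε = ℚ.positive⁻¹ (½ ℚ.* ε) {{ℚ.pos*pos⇒pos ½ ε {{ℚ.positive 0<ε}}}}

  halves : ∀ ε → ½ ℚ.* ε ℚ.+ ½ ℚ.* ε ≡ ε
  halves ε = trans (sym (ℚ.*-distribʳ-+ ε ½ ½)) (ℚ.*-identityˡ ε)

  dist-comm : ∀ p q → dist p q ≡ dist q p
  dist-comm p q = trans (sym (ℚ.∣-p∣≡∣p∣ (p ℚ.- q))) (cong ℚ.∣_∣ lem)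
    where
    open +-*-Solver
    lem : ℚ.- (p ℚ.- q) ≡ q ℚ.- p
    lem = solve 2 (λ p q → :- (p :- q) := q :- p) refl p q

  dist-- : ∀ p q p′ q′ → dist (p ℚ.- q) (p′ ℚ.- q′) ℚ.≤ dist p p′ ℚ.+ dist q q′
  dist-- p q p′ q′ = subst (λ r → ℚ.∣ r ∣ ℚ.≤ dist p p′ ℚ.+ dist q q′) lem
    (ℚ.∣p-q∣≤∣p∣+∣q∣ (p ℚ.- p′) (q ℚ.- q′))
    where
    open +-*-Solver
    lem : (p ℚ.- p′) ℚ.- (q ℚ.- q′) ≡ (p ℚ.- q) ℚ.- (p′ ℚ.- q′)
    lem = solve 4 (λ p q p′ q′ → (p :- p′) :- (q :- q′) := (p :- q) :- (p′ :- q′))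
            refl p q p′ q′

  ∣∣≤ : ∀ p q → ℚ.∣ p ∣ ℚ.≤ dist p q ℚ.+ ℚ.∣ q ∣
  ∣∣≤ p q = subst (λ r → ℚ.∣ r ∣ ℚ.≤ dist p q ℚ.+ ℚ.∣ q ∣) lem
    (ℚ.∣p+q∣≤∣p∣+∣q∣ (p ℚ.- q) q)
    where
    open +-*-Solver
    lem : (p ℚ.- q) ℚ.+ q ≡ p
    lem = solve 2 (λ p q → (p :- q) :+ q := p) refl p q

  ∣∣-∣∣≤ : ∀ p q → ℚ.∣ p ∣ ℚ.- ℚ.∣ q ∣ ℚ.≤ dist p q
  ∣∣-∣∣≤ p q = subst (ℚ.∣ p ∣ ℚ.- ℚ.∣ q ∣ ℚ.≤_) lem
    (ℚ.+-monoˡ-≤ (ℚ.- ℚ.∣ q ∣) (∣∣≤ p q))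
    where
    open +-*-Solver
    lem : (dist p q ℚ.+ ℚ.∣ q ∣) ℚ.- ℚ.∣ q ∣ ≡ dist p q
    lem = solve 2 (λ d a → (d :+ a) :- a := d) refl (dist p q) ℚ.∣ q ∣

  dist-∣∣ : ∀ p q → dist ℚ.∣ p ∣ ℚ.∣ q ∣ ℚ.≤ dist p q
  dist-∣∣ p q with ℚ.∣p∣≡p∨∣p∣≡-p (ℚ.∣ p ∣ ℚ.- ℚ.∣ q ∣)
  ... | inj₁ eq = subst (ℚ._≤ dist p q) (sym eq) (∣∣-∣∣≤ p q)
  ... | inj₂ eq = subst₂ ℚ._≤_ (sym (trans eq lem)) (dist-comm q p) (∣∣-∣∣≤ q p)
    where
    open +-*-Solver
    lem : ℚ.- (ℚ.∣ p ∣ ℚ.- ℚ.∣ q ∣) ≡ ℚ.∣ q ∣ ℚ.- ℚ.∣ p ∣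
    lem = solve 2 (λ p q → :- (p :- q) := q :- p) refl ℚ.∣ p ∣ ℚ.∣ q ∣

  dist-* : ∀ K p q p′ q′ → ℚ.∣ p ∣ ℚ.≤ K → ℚ.∣ q′ ∣ ℚ.≤ K →
           dist (p ℚ.* q) (p′ ℚ.* q′) ℚ.≤ K ℚ.* (dist p p′ ℚ.+ dist q q′)
  dist-* K p q p′ q′ p≤K q′≤K = begin
    ℚ.∣ p ℚ.* q ℚ.- p′ ℚ.* q′ ∣
      ≡⟨ cong ℚ.∣_∣ lem ⟩
    ℚ.∣ p ℚ.* (q ℚ.- q′) ℚ.+ q′ ℚ.* (p ℚ.- p′) ∣
      ≤⟨ ℚ.∣p+q∣≤∣p∣+∣q∣ (p ℚ.* (q ℚ.- q′)) (q′ ℚ.* (p ℚ.- p′)) ⟩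
    ℚ.∣ p ℚ.* (q ℚ.- q′) ∣ ℚ.+ ℚ.∣ q′ ℚ.* (p ℚ.- p′) ∣
      ≡⟨ cong₂ ℚ._+_ (ℚ.∣p*q∣≡∣p∣*∣q∣ p (q ℚ.- q′)) (ℚ.∣p*q∣≡∣p∣*∣q∣ q′ (p ℚ.- p′)) ⟩
    ℚ.∣ p ∣ ℚ.* dist q q′ ℚ.+ ℚ.∣ q′ ∣ ℚ.* dist p p′
      ≤⟨ ℚ.+-mono-≤
           (ℚ.*-monoʳ-≤-nonNeg (dist q q′) {{ℚ.∣-∣-nonNeg (q ℚ.- q′)}} p≤K)
           (ℚ.*-monoʳ-≤-nonNeg (dist p p′) {{ℚ.∣-∣-nonNeg (p ℚ.- p′)}} q′≤K) ⟩
    K ℚ.* dist q q′ ℚ.+ K ℚ.* dist p p′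
      ≡⟨ solve 3 (λ k a b → k :* b :+ k :* a := k :* (a :+ b)) refl K (dist p p′) (dist q q′) ⟩
    K ℚ.* (dist p p′ ℚ.+ dist q q′) ∎
    where
    open ℚ.≤-Reasoning
    open +-*-Solver
    lem : p ℚ.* q ℚ.- p′ ℚ.* q′ ≡ p ℚ.* (q ℚ.- q′) ℚ.+ q′ ℚ.* (p ℚ.- p′)
    lem = solve 4 (λ p q p′ q′ → p :* q :- p′ :* q′ := p :* (q :- q′) :+ q′ :* (p :- p′))
            refl p q p′ q′

  bounded : ∀ x → Cauchy x →
            Σ[ K ∈ ℚ ] ∃[ N ] ∀ {n} → N ℕ.≤ n → ℚ.∣ x n ∣ ℚ.≤ K
  bounded x cx with cx 1ℚ (ℚ.positive⁻¹ 1ℚ)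
  ... | N , h = 1ℚ ℚ.+ ℚ.∣ x N ∣ , N , λ {n} N≤n →
    ℚ.≤-trans (∣∣≤ (x n) (x N))
              (ℚ.+-monoˡ-≤ ℚ.∣ x N ∣ (ℚ.<⇒≤ (h N≤n ℕ.≤-refl)))

  ≤ˡ : ∀ {m n o} → m ℕ.⊔ n ℕ.≤ o → m ℕ.≤ o
  ≤ˡ {m} {n} = ℕ.m⊔n≤o⇒m≤o m n

  ≤ʳ : ∀ {m n o} → m ℕ.⊔ n ℕ.≤ o → n ℕ.≤ o
  ≤ʳ {m} {n} = ℕ.m⊔n≤o⇒n≤o m n

  cauchy-- : ∀ {x y} → Cauchy x → Cauchy y → Cauchy (λ n → x n ℚ.- y n)
  cauchy-- {x} {y} cx cy ε 0<ε with cx (½ ℚ.* ε) (half 0<ε) | cy (½ ℚ.* ε) (half 0<ε)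
  ... | M , hx | N , hy = M ℕ.⊔ N , λ {m} {n} p q →
    ℚ.≤-<-trans (dist-- (x m) (y m) (x n) (y n))
      (subst (dist (x m) (x n) ℚ.+ dist (y m) (y n) ℚ.<_) (halves ε)
        (ℚ.+-mono-< (hx (≤ˡ p) (≤ˡ q)) (hy (≤ʳ {M} p) (≤ʳ {M} q))))

  upperBound : ∀ A B → Σ[ K ∈ ℚ ] 0ℚ ℚ.< K × A ℚ.≤ K × B ℚ.≤ K
  upperBound A B =
    1ℚ ℚ.⊔ (A ℚ.⊔ B) ,
    ℚ.<-≤-trans (ℚ.positive⁻¹ 1ℚ) (ℚ.p≤p⊔q 1ℚ (A ℚ.⊔ B)) ,
    ℚ.≤-trans (ℚ.p≤p⊔q A B) (ℚ.p≤q⊔p 1ℚ (A ℚ.⊔ B)) ,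
    ℚ.≤-trans (ℚ.p≤q⊔p A B) (ℚ.p≤q⊔p 1ℚ (A ℚ.⊔ B))

  quotient : ∀ K ε → 0ℚ ℚ.< K → 0ℚ ℚ.< ε → Σ[ η ∈ ℚ ] 0ℚ ℚ.< η × K ℚ.* η ≡ ε
  quotient K ε 0<K 0<ε =
    ℚ.1/ K ℚ.* ε ,
    ℚ.positive⁻¹ (ℚ.1/ K ℚ.* ε)
      {{ℚ.pos*pos⇒pos (ℚ.1/ K) {{ℚ.1/pos⇒pos K}} ε {{ℚ.positive 0<ε}}}} ,
    trans (sym (ℚ.*-assoc K (ℚ.1/ K) ε))
      (trans (cong (ℚ._* ε) (ℚ.*-inverseʳ K)) (ℚ.*-identityˡ ε))
    where
    instance
      K-pos : ℚ.Positive K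
      K-pos = ℚ.positive 0<K
      K-nz : ℚ.NonZero K
      K-nz = ℚ.pos⇒nonZero K

  cauchy-* : ∀ {x y} → Cauchy x → Cauchy y → Cauchy (λ n → x n ℚ.* y n)
  cauchy-* {x} {y} cx cy ε 0<ε =
    let A , M₁ , hA       = bounded x cx
        B , M₂ , hB       = bounded y cy
        K , 0<K , A≤K , B≤K = upperBound A B
        η , 0<η , Kη      = quotient K ε 0<K 0<ε
        N₁ , hx           = cx (½ ℚ.* η) (half 0<η)
        N₂ , hy           = cy (½ ℚ.* η) (half 0<η)
        M = M₁ ℕ.⊔ M₂
    in M ℕ.⊔ (N₁ ℕ.⊔ N₂) , λ {m} {n} p q →
      combine K η (x m) (y m) (x n) (y n) 0<K Kη
        (ℚ.≤-trans (hA (≤ˡ (≤ˡ {M} p))) A≤K)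
        (ℚ.≤-trans (hB (≤ʳ {M₁} (≤ˡ {M} q))) B≤K)
        (hx (≤ˡ (≤ʳ {M} p)) (≤ˡ (≤ʳ {M} q)))
        (hy (≤ʳ {N₁} (≤ʳ {M} p)) (≤ʳ {N₁} (≤ʳ {M} q)))
    where
    combine : ∀ K η p q p′ q′ → 0ℚ ℚ.< K → K ℚ.* η ≡ ε →
              ℚ.∣ p ∣ ℚ.≤ K → ℚ.∣ q′ ∣ ℚ.≤ K →
              dist p p′ ℚ.< ½ ℚ.* η → dist q q′ ℚ.< ½ ℚ.* η →
              dist (p ℚ.* q) (p′ ℚ.* q′) ℚ.< ε
    combine K η p q p′ q′ 0<K Kη p≤K q′≤K pp′ qq′ =
      ℚ.≤-<-trans (dist-* K p q p′ q′ p≤K q′≤K)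
        (subst (K ℚ.* (dist p p′ ℚ.+ dist q q′) ℚ.<_)
          (trans (cong (K ℚ.*_) (halves η)) Kη)
          (ℚ.*-monoʳ-<-pos K {{ℚ.positive 0<K}} (ℚ.+-mono-< pp′ qq′)))

open CauchyEstimates

-- The value at 0 is junk: it affects only finitely many terms of the
-- inverse of a real apart from 0.
inv : ℚ → ℚ
inv q with q ℚ.≟ 0ℚ
... | yes _   = 0ℚ
... | no  q≢0 = ℚ.1/_ q {{ℚ.≢-nonZero q≢0}}

inv-inverse : ∀ q → q ≢ 0ℚ → inv q ℚ.* q ≡ 1ℚ
inv-inverse q q≢0 with q ℚ.≟ 0ℚ
... | yes q≡0  = ⊥-elim (q≢0 q≡0)
... | no  q≢0′ = ℚ.*-inverseˡ q {{ℚ.≢-nonZero q≢0′}}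

fromℚ : ℚ → ℝ
fromℚ q .seq _ = q
fromℚ q .cauchy ε 0<ε = 0 , λ _ _ →
  subst (ℚ._< ε) (sym (cong ℚ.∣_∣ (ℚ.+-inverseʳ q))) 0<ε

0ℝ 1ℝ : ℝ
0ℝ = fromℚ 0ℚ
1ℝ = fromℚ 1ℚ

infixl 6 _-_
infixl 7 _*_

_-_ : ℝ → ℝ → ℝ
(x - y) .seq n  = seq x n ℚ.- seq y n
(x - y) .cauchy = cauchy-- {seq x} {seq y} (cauchy x) (cauchy y)

_*_ : ℝ → ℝ → ℝ
(x * y) .seq n  = seq x n ℚ.* seq y n
(x * y) .cauchy = cauchy-* {seq x} {seq y} (cauchy x) (cauchy y)

∣_∣ : ℝ → ℝ
∣ x ∣ .seq n = ℚ.∣ seq x n ∣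
∣ x ∣ .cauchy ε 0<ε with cauchy x ε 0<ε
... | N , h = N , λ {m} {n} p q → ℚ.≤-<-trans (dist-∣∣ (seq x m) (seq x n)) (h p q)

module InverseEstimates where

  #0⇒away : ∀ y → y # 0ℝ →
    Σ[ ε ∈ ℚ ] 0ℚ ℚ.< ε × (∃[ N ] ∀ {n} → N ℕ.≤ n → ε ℚ.≤ ℚ.∣ seq y n ∣)
  #0⇒away y (inj₂ (ε , 0<ε , N , h)) = ε , 0<ε , N , λ {n} p →
    let ε≤y = subst (ℚ._≤ seq y n) (ℚ.+-identityˡ ε) (h p)
    in subst (ε ℚ.≤_) (sym (ℚ.0≤p⇒∣p∣≡p (ℚ.≤-trans (ℚ.<⇒≤ 0<ε) ε≤y))) ε≤y
  #0⇒away y (inj₁ (ε , 0<ε , N , h)) = ε , 0<ε , N , λ {n} p →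
    let ε≤-y = subst₂ ℚ._≤_ (lem₁ (seq y n)) (ℚ.+-identityˡ (ℚ.- seq y n))
                 (ℚ.+-monoˡ-≤ (ℚ.- seq y n) (h p))
    in subst (ε ℚ.≤_)
         (trans (sym (ℚ.0≤p⇒∣p∣≡p (ℚ.≤-trans (ℚ.<⇒≤ 0<ε) ε≤-y))) (ℚ.∣-p∣≡∣p∣ (seq y n)))
         ε≤-y
    where
    open +-*-Solver
    lem₁ : ∀ q → q ℚ.+ ε ℚ.- q ≡ ε
    lem₁ q = solve 2 (λ q e → q :+ e :- q := e) refl q ε

  away⇒≢0 : ∀ {ε q} → 0ℚ ℚ.< ε → ε ℚ.≤ ℚ.∣ q ∣ → q ≢ 0ℚ
  away⇒≢0 0<ε ε≤q refl = ℚ.<-irrefl refl (ℚ.<-≤-trans 0<ε ε≤q)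

  -- dist (inv p) (inv q) · ε² ≤ dist (inv p) (inv q) · ∣p∣ · ∣q∣ = dist q p
  dist-inv : ∀ ε p q → 0ℚ ℚ.< ε → ε ℚ.≤ ℚ.∣ p ∣ → ε ℚ.≤ ℚ.∣ q ∣ →
             dist (inv p) (inv q) ℚ.* (ε ℚ.* ε) ℚ.≤ dist p q
  dist-inv ε p q 0<ε ε≤p ε≤q = begin
    d ℚ.* (ε ℚ.* ε)
      ≤⟨ ℚ.*-monoˡ-≤-nonNeg d (ℚ.≤-trans
           (ℚ.*-monoˡ-≤-nonNeg ε ε≤q)
           (ℚ.*-monoʳ-≤-nonNeg ℚ.∣ q ∣ ε≤p)) ⟩
    d ℚ.* (ℚ.∣ p ∣ ℚ.* ℚ.∣ q ∣)
      ≡⟨ cong (d ℚ.*_) (ℚ.∣p*q∣≡∣p∣*∣q∣ p q) ⟨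
    d ℚ.* ℚ.∣ p ℚ.* q ∣
      ≡⟨ ℚ.∣p*q∣≡∣p∣*∣q∣ (inv p ℚ.- inv q) (p ℚ.* q) ⟨
    ℚ.∣ (inv p ℚ.- inv q) ℚ.* (p ℚ.* q) ∣
      ≡⟨ cong ℚ.∣_∣ lem ⟩
    dist q p
      ≡⟨ dist-comm q p ⟩
    dist p q ∎
    where
    open ℚ.≤-Reasoning
    open +-*-Solver
    d = dist (inv p) (inv q)
    instance
      d≥0 : ℚ.NonNegative d
      d≥0 = ℚ.∣-∣-nonNeg (inv p ℚ.- inv q)
      ε≥0 : ℚ.NonNegative ε
      ε≥0 = ℚ.nonNegative (ℚ.<⇒≤ 0<ε)
      q≥0 : ℚ.NonNegative ℚ.∣ q ∣
      q≥0 = ℚ.∣-∣-nonNeg q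
    lem : (inv p ℚ.- inv q) ℚ.* (p ℚ.* q) ≡ q ℚ.- p
    lem = begin-equality
      (inv p ℚ.- inv q) ℚ.* (p ℚ.* q)
        ≡⟨ solve 4 (λ i j p q → (i :- j) :* (p :* q) := (i :* p) :* q :- (j :* q) :* p)
             refl (inv p) (inv q) p q ⟩
      (inv p ℚ.* p) ℚ.* q ℚ.- (inv q ℚ.* q) ℚ.* p
        ≡⟨ cong₂ (λ a b → a ℚ.* q ℚ.- b ℚ.* p)
             (inv-inverse p (away⇒≢0 0<ε ε≤p)) (inv-inverse q (away⇒≢0 0<ε ε≤q)) ⟩
      1ℚ ℚ.* q ℚ.- 1ℚ ℚ.* p
        ≡⟨ cong₂ ℚ._-_ (ℚ.*-identityˡ q) (ℚ.*-identityˡ p) ⟩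
      q ℚ.- p ∎

open InverseEstimates

inverse : (y : ℝ) → y # 0ℝ → ℝ
inverse y y#0 .seq n = inv (seq y n)
inverse y y#0 .cauchy η 0<η with #0⇒away y y#0
... | ε , 0<ε , M , away = answer
  where
  instance
    ε-pos : ℚ.Positive ε
    ε-pos = ℚ.positive 0<ε
    ε²-pos : ℚ.Positive (ε ℚ.* ε)
    ε²-pos = ℚ.pos*pos⇒pos ε ε
    ε²-nonNeg : ℚ.NonNegative (ε ℚ.* ε)
    ε²-nonNeg = ℚ.pos⇒nonNeg (ε ℚ.* ε)
    η-pos : ℚ.Positive η
    η-pos = ℚ.positive 0<η
  answer : ∃[ N ] ∀ {m n} → N ℕ.≤ m → N ℕ.≤ n →
           dist (inv (seq y m)) (inv (seq y n)) ℚ.< η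
  answer with cauchy y (η ℚ.* (ε ℚ.* ε))
                (ℚ.positive⁻¹ (η ℚ.* (ε ℚ.* ε)) {{ℚ.pos*pos⇒pos η (ε ℚ.* ε)}})
  ... | N , h = M ℕ.⊔ N , λ {m} {n} p q →
    ℚ.*-cancelʳ-<-nonNeg (ε ℚ.* ε)
      (ℚ.≤-<-trans (dist-inv ε (seq y m) (seq y n) 0<ε (away (≤ˡ p)) (away (≤ˡ q)))
        (h (≤ʳ {M} p) (≤ʳ {M} q)))

divide : (x y : ℝ) → y # 0ℝ → ℝ
divide x y y#0 = x * inverse y y#0

infix 4 LimInf_≤_

-- liminf x ≤ r. In the extended reals, liminf x is the supremum of the
-- eventual lower bounds of x, so it is at most r exactly when r bounds all
-- of them; this also covers liminf x = ±∞.
LimInf_≤_ : (ℕ → ℝ) → ℝ → Set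
LimInf x ≤ r = ∀ b → (∃[ N ] ∀ {s} → N ℕ.≤ s → b ≤ x s) → b ≤ r

Rational : ℝ → Set
Rational α = ∃[ q ] α ≃ fromℚ q

Irrational : ℝ → Set
Irrational α = ∀ q → α # fromℚ q

#⇒-#0 : ∀ x y → x # y → (x - y) # 0ℝ
#⇒-#0 x y (inj₁ (ε , 0<ε , N , h)) = inj₁ (ε , 0<ε , N , λ {n} p →
  subst₂ ℚ._≤_ (lem (seq x n) (seq y n)) (ℚ.+-inverseʳ (seq y n))
    (ℚ.+-monoˡ-≤ (ℚ.- seq y n) (h p)))
  where
  open +-*-Solver
  lem : ∀ p q → p ℚ.+ ε ℚ.- q ≡ p ℚ.- q ℚ.+ ε
  lem p q = solve 3 (λ p q e → p :+ e :- q := p :- q :+ e) refl p q ε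
#⇒-#0 x y (inj₂ (ε , 0<ε , N , h)) = inj₂ (ε , 0<ε , N , λ {n} p →
  subst (ℚ._≤ seq x n ℚ.- seq y n) (lem (seq y n))
    (ℚ.+-monoˡ-≤ (ℚ.- seq y n) (h p)))
  where
  open +-*-Solver
  lem : ∀ q → q ℚ.+ ε ℚ.- q ≡ 0ℚ ℚ.+ ε
  lem q = solve 2 (λ q e → q :+ e :- q := con 0ℚ :+ e) refl q ε

------------------------------------------------------------------------
-- Approximations

_ConvergesTo_ : (ℕ → ℚ) → ℝ → Set
a ConvergesTo α = ∀ ε → 0ℚ ℚ.< ε →
  ∃[ N ] ∀ {s} → N ℕ.≤ s → ∣ α - fromℚ (a s) ∣ < fromℚ ε

record Approximation (a : ℕ → ℚ) (α : ℝ) : Set where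
  field
    lower     : ∀ s → 0ℚ ℚ.≤ a s
    upper     : ∀ s → a s ℚ.≤ 1ℚ
    converges : a ConvergesTo α

ComputableApproximation : (ℕ → ℚ) → ℝ → Set
ComputableApproximation a α = Approximation a α × Computableℚ a

Nondecreasing Nonincreasing : (ℕ → ℚ) → Set
Nondecreasing a = ∀ {s t} → s ℕ.≤ t → a s ℚ.≤ a t
Nonincreasing a = ∀ {s t} → s ℕ.≤ t → a t ℚ.≤ a s

variation : (ℕ → ℚ) → ℕ → ℚ
variation a zero    = 0ℚ
variation a (suc n) = variation a n ℚ.+ dist (a n) (a (suc n))

BoundedVariation : (ℕ → ℚ) → Set
BoundedVariation a = Σ[ B ∈ ℚ ] ∀ n → variation a n ℚ.≤ B

LeftCEApproximation RightCEApproximation DCEApproximation : (ℕ → ℚ) → ℝ → Set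
LeftCEApproximation  a α = ComputableApproximation a α × Nondecreasing a
RightCEApproximation a α = ComputableApproximation a α × Nonincreasing a
DCEApproximation     a α = ComputableApproximation a α × BoundedVariation a

LeftCE RightCE DCE : ℝ → Set
LeftCE  α = ∃[ a ] LeftCEApproximation a α
RightCE α = ∃[ a ] RightCEApproximation a α
DCE     α = ∃[ a ] DCEApproximation a α

------------------------------------------------------------------------
-- Speedability

speedupRatio : (α : ℝ) → Irrational α → (ℕ → ℚ) → (ℕ → ℕ) → ℕ → ℝ
speedupRatio α irr a f s =
  ∣ divide (α - fromℚ (a (f s))) (α - fromℚ (a s))
           (#⇒-#0 α (fromℚ (a s)) (irr (a s))) ∣

_-Speedable : ℚ → (ℕ → ℚ) → ℝ → Set
(ρ -Speedable) a α =
  Rational α ⊎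
  (Σ[ irr ∈ Irrational α ] Σ[ f ∈ (ℕ → ℕ) ]
     ComputableOrder f × LimInf speedupRatio α irr a f ≤ fromℚ ρ)

Speedable : (ℕ → ℚ) → ℝ → Set
Speedable a α = Σ[ ρ ∈ ℚ ] 0ℚ ℚ.≤ ρ × ρ ℚ.< 1ℚ × (ρ -Speedable) a α

FullyDCESpeedable : ℝ → Set
FullyDCESpeedable α = DCE α × (∀ a → DCEApproximation a α → Speedable a α)

{-# OPTIONS --safe #-}
module Submission where

-- Suppose no computable order speeds up a with ratio ρ = 7/8, and cut the
-- time axis into consecutive blocks, each ending as soon as one of its terms
-- lies in the middle half of the interval [l , h] spanned by its terms. A
-- block does end: otherwise, once a is nearly constant, the terms seen so far
-- form two clusters near l and h, and the last jump into the cluster of α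
-- makes the order s ↦ s + 1 successful. So the blocks are computable, and so
-- is the order sending s to the middle term c of its block. Since that order
-- (preceded by s ↦ s − 1 to reach the right end of the block) fails too, α is
-- almost as far from c as from l and from h, which is impossible if
-- l < α < h. But a crosses α infinitely often: if a stayed below (above) α,
-- its running maxima (minima) would make α left-c.e. (right-c.e.).
-- Here it matters that an order may satisfy f(s) < s.

open import Defs
open import Axiom.ExcludedMiddle using (ExcludedMiddle)
open import Data.Empty using (⊥; ⊥-elim)
open import Data.Fin.Base using (Fin)
open import Data.Fin.Patterns
open import Data.Integer.Base as ℤ using (_⊖_; +_)
import Data.Integer.Properties as ℤ
import Data.Integer.Solver as ℤSolver
open import Data.Nat.Base as ℕ using (ℕ; zero; suc; _+_; _∸_; _⊔_)
import Data.Nat.Properties as ℕ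
open import Data.Product.Base using (Σ-syntax; ∃-syntax; _×_; _,_; proj₁; proj₂)
open import Data.Rational.Base as ℚ using (ℚ; 0ℚ; ½; fromℚᵘ; toℚᵘ)
import Data.Rational.Properties as ℚ
open import Data.Rational.Solver using (module +-*-Solver)
open import Data.Rational.Unnormalised.Base as ℚᵘ using (mkℚᵘ; *≡*; *≤*)
import Data.Rational.Unnormalised.Properties as ℚᵘ
open import Data.Sum.Base using (_⊎_; inj₁; inj₂; [_,_]′)
open import Data.Vec.Base using (Vec; []; _∷_; lookup)
open import Data.Vec.Relation.Binary.Pointwise.Inductive using ([]; _∷_)
open import Function.Base using (_∘_)
open import Level using (0ℓ)
open import Relation.Binary.PropositionalEquality
open import Relation.Nullary using (¬_; yes; no)
open import Relation.Nullary.Decidable using (decidable-stable)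

-- Closure properties of computable functions

record Comp {n} (F : Vec ℕ n → ℕ) : Set where
  constructor mkComp
  field
    code : Code n
    eval : ∀ xs → code [ xs ]⇓ F xs

open Comp

Comp₁ : (ℕ → ℕ) → Set
Comp₁ f = Comp {1} λ xs → f (lookup xs 0F)

Comp₂ : (ℕ → ℕ → ℕ) → Set
Comp₂ f = Comp {2} λ xs → f (lookup xs 0F) (lookup xs 1F)

Comp₃ : (ℕ → ℕ → ℕ → ℕ) → Set
Comp₃ f = Comp {3} λ xs → f (lookup xs 0F) (lookup xs 1F) (lookup xs 2F)

⟦_⟧ : ∀ {f} → Computable f → Comp₁ f
⟦ c , h ⟧ = mkComp c λ { (x ∷ []) → h x }

toComputable : ∀ {f} → Comp₁ f → Computable f
toComputable c = code c , λ n → eval c (n ∷ [])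

module _ {n : ℕ} where

  var : (i : Fin n) → Comp λ xs → lookup xs i
  var i = mkComp (proj i) λ _ → proj⇓

  app₁ : (f : ℕ → ℕ) → Comp₁ f → {G : Vec ℕ n → ℕ} → Comp G → Comp λ xs → f (G xs)
  app₁ f c g = mkComp (comp (code c) (code g ∷ []))
    λ xs → comp⇓ (eval g xs ∷ []) (eval c _)

  app₂ : (f : ℕ → ℕ → ℕ) → Comp₂ f → {G H : Vec ℕ n → ℕ} → Comp G → Comp H →
         Comp λ xs → f (G xs) (H xs)
  app₂ f c g h = mkComp (comp (code c) (code g ∷ code h ∷ []))
    λ xs → comp⇓ (eval g xs ∷ eval h xs ∷ []) (eval c _)

  app₃ : (f : ℕ → ℕ → ℕ → ℕ) → Comp₃ f → {G H K : Vec ℕ n → ℕ} →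
         Comp G → Comp H → Comp K → Comp λ xs → f (G xs) (H xs) (K xs)
  app₃ f c g h k = mkComp (comp (code c) (code g ∷ code h ∷ code k ∷ []))
    λ xs → comp⇓ (eval g xs ∷ eval h xs ∷ eval k xs ∷ []) (eval c _)

  suc-comp : {G : Vec ℕ n → ℕ} → Comp G → Comp λ xs → suc (G xs)
  suc-comp = app₁ suc (mkComp succ λ { (_ ∷ []) → succ⇓ })

  const-comp : ∀ k → Comp {n} λ _ → k
  const-comp zero    = mkComp zer λ _ → zer⇓
  const-comp (suc k) = suc-comp (const-comp k)

rec₁ : (f : ℕ → ℕ) (s : ℕ → ℕ → ℕ) → Comp₂ s →
       (∀ k → f (suc k) ≡ s k (f k)) → Comp₁ f
rec₁ f s cs f-suc = mkComp (prec (code z) (code cs)) λ { (k ∷ []) → go k }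
  where
  z = const-comp {0} (f 0)
  go : ∀ k → prec (code z) (code cs) [ k ∷ [] ]⇓ f k
  go zero    = prec⇓0 (eval z [])
  go (suc k) rewrite f-suc k = prec⇓s (go k) (eval cs _)

rec₂ : (f : ℕ → ℕ → ℕ) (b : ℕ → ℕ) (s : ℕ → ℕ → ℕ → ℕ) → Comp₁ b → Comp₃ s →
       (∀ x → f 0 x ≡ b x) → (∀ k x → f (suc k) x ≡ s k (f k x) x) → Comp₂ f
rec₂ f b s cb cs f-zero f-suc =
  mkComp (prec (code cb) (code cs)) λ { (k ∷ x ∷ []) → go x k }
  where
  go : ∀ x k → prec (code cb) (code cs) [ k ∷ x ∷ [] ]⇓ f k x
  go x zero    rewrite f-zero x  = prec⇓0 (eval cb _)
  go x (suc k) rewrite f-suc k x = prec⇓s (go x k) (eval cs _)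

record Least (g : ℕ → ℕ) : Set where
  constructor least
  field
    value   : ℕ
    isZero  : g value ≡ 0
    minimal : ∀ {k} → g k ≡ 0 → value ℕ.≤ k

open Least

findLeast : (g : ℕ → ℕ) → ∀ b → g b ≡ 0 → Least g
findLeast g b gb with g 0 in eq
findLeast g b       gb | zero  = least 0 eq λ _ → ℕ.z≤n
findLeast g zero    gb | suc v with () ← trans (sym eq) gb
findLeast g (suc b) gb | suc v with findLeast (g ∘ suc) b gb
... | least y z m = least (suc y) z minimal′
  where
  minimal′ : ∀ {k} → g k ≡ 0 → suc y ℕ.≤ k
  minimal′ {zero}  g0 = ⊥-elim (ℕ.0≢1+n (trans (sym g0) eq))
  minimal′ {suc k} gk = ℕ.s≤s (m gk)

-- `G` is total, so every argument below the least zero converges to a positive value, as `mini⇓`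
-- demands. The bound used to find the zero never enters the code.
mini-comp : ∀ {n} {G : Vec ℕ (suc n) → ℕ} → Comp G →
            (μ : ∀ xs → Least (λ y → G (y ∷ xs))) → Comp λ xs → value (μ xs)
mini-comp {G = G} c μ = mkComp (mini (code c)) λ xs →
  mini⇓ (below xs) (subst (code c [ _ ]⇓_) (isZero (μ xs)) (eval c _))
  where
  below : ∀ xs {k} → k ℕ.< value (μ xs) → ∃[ v ] code c [ k ∷ xs ]⇓ suc v
  below xs {k} k<μ with G (k ∷ xs) in eq
  ... | zero  = ⊥-elim (ℕ.<⇒≱ k<μ (minimal (μ xs) eq))
  ... | suc v = v , subst (code c [ _ ]⇓_) eq (eval c _)

+-comp : Comp₂ _+_
+-comp = rec₂ _+_ _ (λ _ y _ → suc y) (var 0F) (suc-comp (var 1F))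
  (λ _ → refl) (λ _ _ → refl)

*-comp : Comp₂ ℕ._*_
*-comp = rec₂ ℕ._*_ _ (λ _ y x → x + y) (const-comp 0) (app₂ _+_ +-comp (var 2F) (var 1F))
  (λ _ → refl) (λ _ _ → refl)

pred-comp : Comp₁ ℕ.pred
pred-comp = rec₁ ℕ.pred (λ k _ → k) (var 0F) (λ _ → refl)

∸-comp : Comp₂ _∸_
-- The recursion runs on the subtrahend, hence the two swaps of arguments.
∸-comp = app₂ (λ x y → y ∸ x) (rec₂ (λ x y → y ∸ x) _ (λ _ y _ → ℕ.pred y)
    (var 0F) (app₁ ℕ.pred pred-comp (var 1F)) (λ _ → refl)
    (λ k x → sym (ℕ.pred[m∸n]≡m∸[1+n] x k)))
  (var 1F) (var 0F)

ifZero : ℕ → ℕ → ℕ → ℕ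
ifZero zero    y z = y
ifZero (suc _) y z = z

ifZero-comp : Comp₃ ifZero
ifZero-comp = mkComp (prec (proj 0F) (proj 3F)) λ { (k ∷ y ∷ z ∷ []) → go k y z }
  where
  go : ∀ k y z → prec (proj 0F) (proj 3F) [ k ∷ y ∷ z ∷ [] ]⇓ ifZero k y z
  go zero    y z = prec⇓0 proj⇓
  go (suc k) y z = prec⇓s (go k y z) proj⇓

module _ {n : ℕ} {G H : Vec ℕ n → ℕ} where

  infixl 6 _⊕_ _⊝_
  infixl 7 _⊛_

  _⊕_ : Comp G → Comp H → Comp λ xs → G xs + H xs
  _⊕_ = app₂ _+_ +-comp

  _⊛_ : Comp G → Comp H → Comp λ xs → G xs ℕ.* H xs
  _⊛_ = app₂ ℕ._*_ *-comp

  _⊝_ : Comp G → Comp H → Comp λ xs → G xs ∸ H xs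
  _⊝_ = app₂ _∸_ ∸-comp

-- Computable rational-valued functions and decidable comparisons

record Compℚ {n} (A : Vec ℕ n → ℚ) : Set where
  field
    {pos neg den} : Vec ℕ n → ℕ
    pos-comp      : Comp pos
    neg-comp      : Comp neg
    den-comp      : Comp den
    value-≡       : ∀ xs → A xs ≡ (pos xs ⊖ neg xs) ℚ./ suc (den xs)

open Compℚ

fraction : ℕ → ℕ → ℕ → ℚ
fraction p q r = (p ⊖ q) ℚ./ suc r

fromℚᵘ-homo-+ : ∀ u v → fromℚᵘ u ℚ.+ fromℚᵘ v ≡ fromℚᵘ (u ℚᵘ.+ v)
fromℚᵘ-homo-+ u v = ℚ.toℚᵘ-injective (begin-equality
  toℚᵘ (fromℚᵘ u ℚ.+ fromℚᵘ v)
    ≃⟨ ℚ.toℚᵘ-homo-+ (fromℚᵘ u) (fromℚᵘ v) ⟩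
  toℚᵘ (fromℚᵘ u) ℚᵘ.+ toℚᵘ (fromℚᵘ v)
    ≃⟨ ℚᵘ.+-cong (ℚ.toℚᵘ-fromℚᵘ u) (ℚ.toℚᵘ-fromℚᵘ v) ⟩
  u ℚᵘ.+ v
    ≃⟨ ℚ.toℚᵘ-fromℚᵘ (u ℚᵘ.+ v) ⟨
  toℚᵘ (fromℚᵘ (u ℚᵘ.+ v)) ∎)
  where open ℚᵘ.≤-Reasoning

fraction-+ : ∀ p q r p′ q′ r′ → fraction p q r ℚ.+ fraction p′ q′ r′ ≡
  fraction (p ℕ.* suc r′ + p′ ℕ.* suc r) (q ℕ.* suc r′ + q′ ℕ.* suc r) (r′ + r ℕ.* suc r′)
fraction-+ p q r p′ q′ r′ = trans
  (fromℚᵘ-homo-+ (mkℚᵘ (p ⊖ q) r) (mkℚᵘ (p′ ⊖ q′) r′))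
  (cong (λ i → i ℚ./ suc (r′ + r ℕ.* suc r′)) (begin
    (p ⊖ q) ℤ.* + suc r′ ℤ.+ (p′ ⊖ q′) ℤ.* + suc r
      ≡⟨ cong₂ (λ i j → i ℤ.* + suc r′ ℤ.+ j ℤ.* + suc r)
           (ℤ.[+m]-[+n]≡m⊖n p q) (ℤ.[+m]-[+n]≡m⊖n p′ q′) ⟨
    (+ p ℤ.- + q) ℤ.* + suc r′ ℤ.+ (+ p′ ℤ.- + q′) ℤ.* + suc r
      ≡⟨ solve 6 (λ p q p′ q′ d d′ →
           (p :- q) :* d′ :+ (p′ :- q′) :* d := (p :* d′ :+ p′ :* d) :- (q :* d′ :+ q′ :* d))
           refl (+ p) (+ q) (+ p′) (+ q′) (+ suc r) (+ suc r′) ⟩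
    (+ p ℤ.* + suc r′ ℤ.+ + p′ ℤ.* + suc r) ℤ.- (+ q ℤ.* + suc r′ ℤ.+ + q′ ℤ.* + suc r)
      ≡⟨ cong₂ ℤ._-_ (pull p p′) (pull q q′) ⟨
    + (p ℕ.* suc r′ + p′ ℕ.* suc r) ℤ.- + (q ℕ.* suc r′ + q′ ℕ.* suc r)
      ≡⟨ ℤ.[+m]-[+n]≡m⊖n (p ℕ.* suc r′ + p′ ℕ.* suc r) (q ℕ.* suc r′ + q′ ℕ.* suc r) ⟩
    (p ℕ.* suc r′ + p′ ℕ.* suc r) ⊖ (q ℕ.* suc r′ + q′ ℕ.* suc r) ∎))
  where
  open ≡-Reasoning
  open ℤSolver.+-*-Solver
  pull : ∀ m m′ → + (m ℕ.* suc r′ + m′ ℕ.* suc r) ≡ + m ℤ.* + suc r′ ℤ.+ + m′ ℤ.* + suc r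
  pull m m′ = cong₂ ℤ._+_ (ℤ.pos-* m (suc r′)) (ℤ.pos-* m′ (suc r))

-- By `fraction-+` the two fractions add up to zero; uniqueness of negatives then avoids unfolding
-- the reduction to lowest terms.
fraction-neg : ∀ p q r → ℚ.- fraction p q r ≡ fraction q p r
fraction-neg p q r = begin
  ℚ.- fraction p q r                                ≡⟨ ℚ.+-identityʳ _ ⟨
  ℚ.- fraction p q r ℚ.+ 0ℚ                         ≡⟨ cong (ℚ.- fraction p q r ℚ.+_) cancel ⟨
  ℚ.- fraction p q r ℚ.+ (fraction p q r ℚ.+ fraction q p r)
    ≡⟨ ℚ.+-assoc (ℚ.- fraction p q r) (fraction p q r) (fraction q p r) ⟨
  (ℚ.- fraction p q r ℚ.+ fraction p q r) ℚ.+ fraction q p r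
    ≡⟨ cong (ℚ._+ fraction q p r) (ℚ.+-inverseˡ (fraction p q r)) ⟩
  0ℚ ℚ.+ fraction q p r                             ≡⟨ ℚ.+-identityˡ _ ⟩
  fraction q p r                                    ∎
  where
  open ≡-Reasoning
  cancel : fraction p q r ℚ.+ fraction q p r ≡ 0ℚ
  cancel = begin
    fraction p q r ℚ.+ fraction q p r ≡⟨ fraction-+ p q r q p r ⟩
    fraction (p ℕ.* suc r + q ℕ.* suc r) (q ℕ.* suc r + p ℕ.* suc r) (r + r ℕ.* suc r)
      ≡⟨ cong (ℚ._/ suc (r + r ℕ.* suc r)) (trans
           (cong (_⊖ (q ℕ.* suc r + p ℕ.* suc r)) (ℕ.+-comm (p ℕ.* suc r) (q ℕ.* suc r)))
           (ℤ.n⊖n≡0 (q ℕ.* suc r + p ℕ.* suc r))) ⟩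
    ℤ.0ℤ ℚ./ suc (r + r ℕ.* suc r)
      ≡⟨ ℚ.fromℚᵘ-cong {mkℚᵘ ℤ.0ℤ (r + r ℕ.* suc r)} {mkℚᵘ ℤ.0ℤ 0} (*≡* refl) ⟩
    0ℚ ∎

-- The sign of a fraction is that of its numerator, so comparing rationals reduces to comparing
-- naturals, which truncated subtraction decides.
fraction≤0⇒ : ∀ {p q r} → fraction p q r ℚ.≤ 0ℚ → p ℕ.≤ q
fraction≤0⇒ {p} {q} {r} le with
  ℚᵘ.≤-respˡ-≃ (ℚ.toℚᵘ-fromℚᵘ (mkℚᵘ (p ⊖ q) r)) (ℚ.toℚᵘ-mono-≤ le)
... | *≤* le′ = ℕ.≮⇒≥ λ q<p → ℤ.≤⇒≯ (subst (ℤ._≤ ℤ.0ℤ) (ℤ.*-identityʳ (p ⊖ q)) le′)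
  (subst (ℤ._< p ⊖ q) (ℤ.n⊖n≡0 q) (ℤ.⊖-monoˡ-< q q<p))

⇒fraction≤0 : ∀ {p q} r → p ℕ.≤ q → fraction p q r ℚ.≤ 0ℚ
⇒fraction≤0 {p} {q} r p≤q = ℚ.toℚᵘ-cancel-≤ (ℚᵘ.≤-respˡ-≃
  (ℚᵘ.≃-sym (ℚ.toℚᵘ-fromℚᵘ (mkℚᵘ (p ⊖ q) r)))
  (*≤* (subst (ℤ._≤ ℤ.0ℤ) (sym (ℤ.*-identityʳ (p ⊖ q)))
    (subst (p ⊖ q ℤ.≤_) (ℤ.n⊖n≡0 q) (ℤ.⊖-monoˡ-≤ q p≤q)))))

infix  8 -ℚ_
infixl 6 _+ℚ_ _-ℚ_

_+ℚ_ : ∀ {n} {A B : Vec ℕ n → ℚ} → Compℚ A → Compℚ B → Compℚ λ xs → A xs ℚ.+ B xs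
x +ℚ y = record
  { pos-comp = pos-comp x ⊛ suc-comp (den-comp y) ⊕ pos-comp y ⊛ suc-comp (den-comp x)
  ; neg-comp = neg-comp x ⊛ suc-comp (den-comp y) ⊕ neg-comp y ⊛ suc-comp (den-comp x)
  ; den-comp = den-comp y ⊕ den-comp x ⊛ suc-comp (den-comp y)
  ; value-≡  = λ xs → trans (cong₂ ℚ._+_ (value-≡ x xs) (value-≡ y xs))
      (fraction-+ (pos x xs) (neg x xs) (den x xs) (pos y xs) (neg y xs) (den y xs))
  }

-ℚ_ : ∀ {n} {A : Vec ℕ n → ℚ} → Compℚ A → Compℚ λ xs → ℚ.- A xs
-ℚ x = record
  { pos-comp = neg-comp x
  ; neg-comp = pos-comp x
  ; den-comp = den-comp x
  ; value-≡  = λ xs → trans (cong ℚ.-_ (value-≡ x xs))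
      (fraction-neg (pos x xs) (neg x xs) (den x xs))
  }

_-ℚ_ : ∀ {n} {A B : Vec ℕ n → ℚ} → Compℚ A → Compℚ B → Compℚ λ xs → A xs ℚ.- B xs
x -ℚ y = x +ℚ (-ℚ y)

appℚ : ∀ {n} {a : ℕ → ℚ} → Computableℚ a → {G : Vec ℕ n → ℕ} → Comp G → Compℚ λ xs → a (G xs)
appℚ (p , q , r , cp , cq , cr , eq) {G} g = record
  { pos-comp = app₁ p ⟦ cp ⟧ g
  ; neg-comp = app₁ q ⟦ cq ⟧ g
  ; den-comp = app₁ r ⟦ cr ⟧ g
  ; value-≡  = λ xs → eq (G xs)
  }

reindex : ∀ {a f} → Computableℚ a → Comp₁ f → Computableℚ (a ∘ f)
reindex {f = f} (p , q , r , cp , cq , cr , eq) cf =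
  p ∘ f , q ∘ f , r ∘ f ,
  toComputable (app₁ p ⟦ cp ⟧ cf) , toComputable (app₁ q ⟦ cq ⟧ cf) ,
  toComputable (app₁ r ⟦ cr ⟧ cf) , λ s → eq (f s)

p-q≤0⇒p≤q : ∀ {p q} → p ℚ.- q ℚ.≤ 0ℚ → p ℚ.≤ q
p-q≤0⇒p≤q {p} {q} le = subst₂ ℚ._≤_
  (trans (ℚ.+-assoc p (ℚ.- q) q) (trans (cong (p ℚ.+_) (ℚ.+-inverseˡ q)) (ℚ.+-identityʳ p)))
  (ℚ.+-identityˡ q) (ℚ.+-monoˡ-≤ q le)

p≤q⇒p-q≤0 : ∀ {p q} → p ℚ.≤ q → p ℚ.- q ℚ.≤ 0ℚ
p≤q⇒p-q≤0 {p} {q} le = subst (p ℚ.- q ℚ.≤_) (ℚ.+-inverseʳ q) (ℚ.+-monoˡ-≤ (ℚ.- q) le)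

-- Truth is encoded by 0, the value that minimisation looks for.
record Test {n} (P : Vec ℕ n → Set) : Set where
  field
    {fun}    : Vec ℕ n → ℕ
    fun-comp : Comp fun
    sound    : ∀ xs → fun xs ≡ 0 → P xs
    complete : ∀ xs → P xs → fun xs ≡ 0

open Test

≤-test : ∀ {n} {A B : Vec ℕ n → ℚ} → Compℚ A → Compℚ B → Test λ xs → A xs ℚ.≤ B xs
≤-test {A = A} {B} x y = record
  { fun-comp = pos-comp z ⊝ neg-comp z
  ; sound    = λ xs eq → p-q≤0⇒p≤q (subst (ℚ._≤ 0ℚ) (sym (value-≡ z xs))
      (⇒fraction≤0 (den z xs) (ℕ.m∸n≡0⇒m≤n {pos z xs} {neg z xs} eq)))
  ; complete = λ xs le → ℕ.m≤n⇒m∸n≡0 (fraction≤0⇒ {pos z xs} {neg z xs} {den z xs}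
      (subst (ℚ._≤ 0ℚ) (value-≡ z xs) (p≤q⇒p-q≤0 le)))
  }
  where
  z : Compℚ λ xs → A xs ℚ.- B xs
  z = x -ℚ y

×-test : ∀ {n} {P Q R : Vec ℕ n → Set} →
         (∀ {xs} → P xs → Q xs → R xs) → (∀ {xs} → R xs → P xs × Q xs) →
         Test P → Test Q → Test R
×-test to from s t = record
  { fun-comp = fun-comp s ⊕ fun-comp t
  ; sound    = λ xs eq → to (sound s xs (ℕ.m+n≡0⇒m≡0 _ eq)) (sound t xs (ℕ.m+n≡0⇒n≡0 (fun s xs) eq))
  ; complete = λ xs r → let p , q = from r in cong₂ _+_ (complete s xs p) (complete t xs q)
  }

curry₂ : ∀ {F} → Comp {2} F → Comp₂ λ x y → F (x ∷ y ∷ [])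
curry₂ c = mkComp (code c) λ { (x ∷ y ∷ []) → eval c _ }

curry₃ : ∀ {F} → Comp {3} F → Comp₃ λ x y z → F (x ∷ y ∷ z ∷ [])
curry₃ c = mkComp (code c) λ { (x ∷ y ∷ z ∷ []) → eval c _ }

-- Computable orders

step⇒mono : ∀ {f : ℕ → ℕ} → (∀ n → f n ℕ.≤ f (suc n)) → ∀ {m n} → m ℕ.≤′ n → f m ℕ.≤ f n
step⇒mono step ℕ.≤′-refl          = ℕ.≤-refl
step⇒mono step (ℕ.≤′-step {n} le) = ℕ.≤-trans (step⇒mono step le) (step n)

order : ∀ {f} → Comp₁ f → (∀ n → f n ℕ.≤ f (suc n)) → (∀ k → ∃[ n ] k ℕ.≤ f n) →
        ComputableOrder f
order {f} c step unbdd = record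
  { computable    = toComputable c
  ; nondecreasing = λ m≤n → step⇒mono step (ℕ.≤⇒≤′ m≤n)
  ; unbounded     = unbdd
  }

order-∘ : ∀ {f g} → ComputableOrder f → ComputableOrder g → ComputableOrder (f ∘ g)
order-∘ {f} {g} F G = record
  { computable    = toComputable (app₁ f ⟦ computable F ⟧ ⟦ computable G ⟧)
  ; nondecreasing = λ m≤n → nondecreasing F (nondecreasing G m≤n)
  ; unbounded     = λ k →
      let i , k≤fi = unbounded F k
          j , i≤gj = unbounded G i
      in j , ℕ.≤-trans k≤fi (nondecreasing F i≤gj)
  }
  where open ComputableOrder

suc-order : ComputableOrder suc
suc-order = order (suc-comp (var 0F)) (λ n → ℕ.n≤1+n (suc n)) (λ k → k , ℕ.n≤1+n k)

pred-order : ComputableOrder ℕ.pred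
pred-order = order pred-comp (λ n → ℕ.pred[n]≤n) (λ k → suc k , ℕ.≤-refl)

-- Blocks

module Argmax (a : ℕ → ℚ) (ca : Computableℚ a) where

  abstract
    step-test : Test {2} λ xs → a (lookup xs 0F) ℚ.≤ a (lookup xs 1F)
    step-test = ≤-test (appℚ ca (var 0F)) (appℚ ca (var {2} 1F))

  -- Zero exactly when the term at `i` is at most the term at `j`, so `argmax` moves only to a
  -- strictly larger term.
  gain : ℕ → ℕ → ℕ
  gain i j = fun step-test (i ∷ j ∷ [])

  -- over the window of indices e , … , k + e
  argmax : ℕ → ℕ → ℕ
  argmax zero    e = e
  argmax (suc k) e = ifZero (gain (suc k + e) (argmax k e)) (argmax k e) (suc k + e)

  argmax-comp : Comp₂ argmax
  argmax-comp = rec₂ argmax _ (λ k m e → ifZero (gain (suc k + e) m) m (suc k + e)) (var 0F)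
    (app₃ ifZero ifZero-comp (app₂ gain (curry₂ (fun-comp step-test)) new (var 1F)) (var 1F) new)
    (λ _ → refl) (λ _ _ → refl)
    where
    new : Comp {3} λ xs → suc (lookup xs 0F + lookup xs 2F)
    new = suc-comp (var 0F ⊕ var 2F)

  argmax-bounds : ∀ k e → e ℕ.≤ argmax k e × argmax k e ℕ.≤ k + e
  argmax-bounds zero    e = ℕ.≤-refl , ℕ.≤-refl
  argmax-bounds (suc k) e with gain (suc k + e) (argmax k e)
  ... | zero  = let p , q = argmax-bounds k e in p , ℕ.m≤n⇒m≤1+n q
  ... | suc _ = ℕ.m≤n+m e (suc k) , ℕ.≤-refl

  argmax-step : ∀ k e → a (argmax k e) ℚ.≤ a (argmax (suc k) e) ×
                        a (suc k + e)  ℚ.≤ a (argmax (suc k) e)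
  argmax-step k e with gain (suc k + e) (argmax k e) in eq
  ... | zero  = ℚ.≤-refl , sound step-test (suc k + e ∷ argmax k e ∷ []) eq
  ... | suc v = ℚ.<⇒≤ (ℚ.≰⇒> λ le → ℕ.0≢1+n
    (trans (sym (complete step-test (suc k + e ∷ argmax k e ∷ []) le)) eq)) , ℚ.≤-refl

  argmax-mono : ∀ {k k′} e → k ℕ.≤′ k′ → a (argmax k e) ℚ.≤ a (argmax k′ e)
  argmax-mono e ℕ.≤′-refl            = ℚ.≤-refl
  argmax-mono e (ℕ.≤′-step {k′} k≤k′) = ℚ.≤-trans (argmax-mono e k≤k′) (proj₁ (argmax-step k′ e))

  argmax-last : ∀ k e → a (k + e) ℚ.≤ a (argmax k e)
  argmax-last zero    e = ℚ.≤-refl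
  argmax-last (suc k) e = proj₂ (argmax-step k e)

  -- `j` is the newest index of the window of offset `j ∸ e`, and the maximum can only grow as the
  -- window is extended.
  argmax-max : ∀ k e {j} → e ℕ.≤ j → j ℕ.≤ k + e → a j ℚ.≤ a (argmax k e)
  argmax-max k e {j} e≤j j≤k+e = ℚ.≤-trans
    (subst (λ i → a i ℚ.≤ a (argmax (j ∸ e) e)) (ℕ.m∸n+n≡m e≤j) (argmax-last (j ∸ e) e))
    (argmax-mono e (ℕ.≤⇒≤′ (ℕ.≤-trans (ℕ.∸-monoˡ-≤ e j≤k+e) (ℕ.≤-reflexive (ℕ.m+n∸n≡m k e)))))

negate : ∀ {a} → Computableℚ a → Computableℚ (λ s → ℚ.- a s)
negate (p , q , r , cp , cq , cr , eq) = q , p , r , cq , cp , cr ,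
  λ s → trans (cong ℚ.-_ (eq s)) (fraction-neg (p s) (q s) (r s))

neg-cancel-≤ : ∀ {p q} → ℚ.- p ℚ.≤ ℚ.- q → q ℚ.≤ p
neg-cancel-≤ le = ℚ.≮⇒≥ λ p<q → ℚ.<-irrefl refl (ℚ.<-≤-trans (ℚ.neg-antimono-< p<q) le)

-- p + (q − p) / 4 ≤ r ≤ q − (q − p) / 4, multiplied by 4.
record Middle (p q r : ℚ) : Set where
  constructor middle
  field
    lower : q ℚ.+ (p ℚ.+ (p ℚ.+ p)) ℚ.≤ (r ℚ.+ r) ℚ.+ (r ℚ.+ r)
    upper : (r ℚ.+ r) ℚ.+ (r ℚ.+ r) ℚ.≤ p ℚ.+ (q ℚ.+ (q ℚ.+ q))

module Blocks (a : ℕ → ℚ) (ca : Computableℚ a) where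

  open Argmax a ca public
  open Argmax (λ s → ℚ.- a s) (negate ca) public using ()
    renaming (argmax to argmin; argmax-comp to argmin-comp; argmax-bounds to argmin-bounds)

  argmin-min : ∀ k e {j} → e ℕ.≤ j → j ℕ.≤ k + e → a (argmin k e) ℚ.≤ a j
  argmin-min k e e≤j j≤k+e = neg-cancel-≤ (Argmax.argmax-max (λ s → ℚ.- a s) (negate ca) k e e≤j j≤k+e)

  argmin-last : ∀ k e → a (argmin k e) ℚ.≤ a (k + e)
  argmin-last k e = neg-cancel-≤ (Argmax.argmax-last (λ s → ℚ.- a s) (negate ca) k e)

  argmin-anti : ∀ {k k′} e → k ℕ.≤′ k′ → a (argmin k′ e) ℚ.≤ a (argmin k e)
  argmin-anti e k≤k′ = neg-cancel-≤ (Argmax.argmax-mono (λ s → ℚ.- a s) (negate ca) e k≤k′)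

  MidTerm : ℕ → ℕ → ℕ → Set
  MidTerm k e j = Middle (a (argmin k e)) (a (argmax k e)) (a (j + e))

  abstract
    mid-test : Test {3} λ xs → Middle (a (lookup xs 0F)) (a (lookup xs 1F)) (a (lookup xs 2F))
    mid-test = ×-test middle (λ (middle l u) → l , u)
      (≤-test (term 1F +ℚ (term 0F +ℚ (term 0F +ℚ term 0F)))
              ((term 2F +ℚ term 2F) +ℚ (term 2F +ℚ term 2F)))
      (≤-test ((term 2F +ℚ term 2F) +ℚ (term 2F +ℚ term 2F))
              (term 0F +ℚ (term 1F +ℚ (term 1F +ℚ term 1F))))
      where
      term : (i : Fin 3) → Compℚ λ xs → a (lookup xs i)
      term i = appℚ ca (var i)

  defect : ℕ → ℕ → ℕ → ℕ
  defect l h c = fun mid-test (l ∷ h ∷ c ∷ [])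

  -- The hypothesis is that every block ends. Writing `suc k` excludes one-term windows, whose only
  -- term is trivially a middle term, so each block advances.
  module _ (middle-term : ∀ e → ∃[ k ] ∃[ j ] j ℕ.≤ suc k × MidTerm (suc k) e j) where

    -- vanishes when j exceeds 1 + k, which makes the search for j total
    failure : ℕ → ℕ → ℕ → ℕ
    failure j k e = (suc (suc k) ∸ j) ℕ.* defect (argmin (suc k) e) (argmax (suc k) e) (j + e)

    failure-comp : Comp₃ failure
    failure-comp =
      (suc-comp (suc-comp (var 1F)) ⊝ var 0F) ⊛
      app₃ defect (curry₃ (fun-comp mid-test))
        (app₂ argmin argmin-comp (suc-comp (var 1F)) (var 2F))
        (app₂ argmax argmax-comp (suc-comp (var 1F)) (var 2F))
        (var 0F ⊕ var 2F)

    abstract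
      firstMid : ∀ k e → Least (λ j → failure j k e)
      firstMid k e = findLeast _ (suc (suc k)) (cong
        (λ v → v ℕ.* defect (argmin (suc k) e) (argmax (suc k) e) (suc (suc k) + e)) (ℕ.n∸n≡0 k))

    -- At most `suc k` exactly when the window has a middle term; otherwise the search stops at
    -- `suc (suc k)`.
    offset : ℕ → ℕ → ℕ
    offset k e = value (firstMid k e)

    offset-comp : Comp₂ offset
    offset-comp = mini-comp failure-comp (λ xs → firstMid (lookup xs 0F) (lookup xs 1F))

    abstract
      firstEnd : ∀ e → Least (λ k → offset k e ∸ suc k)
      firstEnd e =
        let k , j , j≤1+k , mid = middle-term e
        in findLeast _ k (ℕ.m≤n⇒m∸n≡0 (ℕ.≤-trans
             (minimal (firstMid k e)
               (trans (cong ((suc (suc k) ∸ j) ℕ.*_)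
                   (complete mid-test (argmin (suc k) e ∷ argmax (suc k) e ∷ j + e ∷ []) mid))
                 (ℕ.*-zeroʳ (suc (suc k) ∸ j))))
             j≤1+k))

    len : ℕ → ℕ
    len e = value (firstEnd e)

    len-comp : Comp₁ len
    len-comp = mini-comp (app₂ offset offset-comp (var 0F) (var 1F) ⊝ suc-comp (var 0F))
      (λ xs → firstEnd (lookup xs 0F))

    -- `end e` is the last index of the window and also the first index of the next block, so the
    -- step from any `s` to `suc s` stays within one window.
    end mid : ℕ → ℕ
    end e = suc (len e) + e
    mid e = offset (len e) e + e

    end-comp : Comp₁ end
    end-comp = suc-comp len-comp ⊕ var 0F

    mid-comp : Comp₁ mid
    mid-comp = app₂ offset offset-comp len-comp (var 0F) ⊕ var 0F

    e<end : ∀ e → e ℕ.< end e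
    e<end e = ℕ.s≤s (ℕ.m≤n+m e (len e))

    e≤mid : ∀ e → e ℕ.≤ mid e
    e≤mid e = ℕ.m≤n+m e (offset (len e) e)

    offset≤ : ∀ e → offset (len e) e ℕ.≤ suc (len e)
    offset≤ e = ℕ.m∸n≡0⇒m≤n (isZero (firstEnd e))

    mid≤end : ∀ e → mid e ℕ.≤ end e
    mid≤end e = ℕ.+-monoˡ-≤ e (offset≤ e)

    offset-middle : ∀ k e → offset k e ℕ.≤ suc k → MidTerm (suc k) e (offset k e)
    offset-middle k e le = sound mid-test
      (argmin (suc k) e ∷ argmax (suc k) e ∷ offset k e + e ∷ [])
      -- The first factor of `failure` is positive inside the window, so the test is the factor that
      -- vanishes.
      ([ (λ eq → ⊥-elim (ℕ.<⇒≱ (ℕ.s≤s le) (ℕ.m∸n≡0⇒m≤n eq))) , (λ eq → eq) ]′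
        (ℕ.m*n≡0⇒m≡0∨n≡0 (suc (suc k) ∸ offset k e)
          {defect (argmin (suc k) e) (argmax (suc k) e) (offset k e + e)}
          (isZero (firstMid k e))))

    mid-middle : ∀ e → MidTerm (suc (len e)) e (offset (len e) e)
    mid-middle e = offset-middle (len e) e (offset≤ e)

    -- the first index of the block [e , end e) containing s
    start : ℕ → ℕ
    start zero    = 0
    start (suc s) = ifZero (end (start s) ∸ suc s) (end (start s)) (start s)

    start-comp : Comp₁ start
    start-comp = rec₁ start (λ s e → ifZero (end e ∸ suc s) (end e) e)
      (app₃ ifZero ifZero-comp (app₁ end end-comp (var 1F) ⊝ suc-comp (var 0F))
        (app₁ end end-comp (var 1F)) (var 1F))
      (λ _ → refl)

    data Step (s : ℕ) : Set where
      same : start (suc s) ≡ start s → suc s ℕ.< end (start s) → Step s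
      next : start (suc s) ≡ suc s → suc s ≡ end (start s) → Step s

    -- Proved together with `step`: the invariant `s < end (start s)` forces a block that is over at
    -- `suc s` to end exactly there.
    start-bounds : ∀ s → start s ℕ.≤ s × s ℕ.< end (start s)
    step : ∀ s → Step s

    start-bounds zero    = ℕ.z≤n , e<end 0
    start-bounds (suc s) with step s
    ... | same eq lt rewrite eq = ℕ.m≤n⇒m≤1+n (proj₁ (start-bounds s)) , lt
    ... | next eq _ rewrite eq = ℕ.≤-refl , e<end (suc s)

    step s with end (start s) ∸ suc s in eq
    ... | zero  = next (trans (cong (λ v → ifZero v (end (start s)) (start s)) eq) (sym same-end)) same-end
      where
      same-end : suc s ≡ end (start s)
      same-end = ℕ.≤-antisym (proj₂ (start-bounds s)) (ℕ.m∸n≡0⇒m≤n eq)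
    ... | suc _ = same (cong (λ v → ifZero v (end (start s)) (start s)) eq)
      (ℕ.≰⇒> λ le → ℕ.0≢1+n (trans (sym (ℕ.m≤n⇒m∸n≡0 le)) eq))

    start-idem : ∀ s → start (start s) ≡ start s
    start-idem zero    = refl
    start-idem (suc s) with step s
    ... | same eq _ rewrite eq = start-idem s
    ... | next eq _ rewrite eq = eq

    start-block : ∀ {e} → start e ≡ e → ∀ i → i + e ℕ.< end e → start (i + e) ≡ e
    start-block         h zero    _  = h
    start-block {e} h (suc i) lt with step (i + e)
    ... | same eq _  = trans eq (start-block h i (ℕ.<-trans (ℕ.n<1+n _) lt))
    ... | next _ eq  = ⊥-elim (ℕ.<-irrefl
      (trans eq (cong end (start-block h i (ℕ.<-trans (ℕ.n<1+n _) lt)))) lt)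

    start-mono : ∀ s → start s ℕ.≤ start (suc s)
    start-mono s with step s
    ... | same eq _ = ℕ.≤-reflexive (sym eq)
    ... | next eq _ = subst (start s ℕ.≤_) (sym eq) (ℕ.m≤n⇒m≤1+n (proj₁ (start-bounds s)))

    start-order : ComputableOrder start
    start-order = order start-comp start-mono unbdd
      where
      unbdd : ∀ k → ∃[ n ] k ℕ.≤ start n
      unbdd zero    = 0 , ℕ.z≤n
      unbdd (suc k) with unbdd k
      ... | n , k≤ with start-bounds n | start-bounds (end (start n))
      ...   | _ , n<end | _ , end< =
        -- Moving to the end of the block of `n` increases `start`: an unchanged start would put
        -- `end (start n)` strictly before itself.
        end (start n) , ℕ.≤-<-trans k≤ (ℕ.≤∧≢⇒< (step⇒mono start-mono (ℕ.≤⇒≤′ (ℕ.<⇒≤ n<end)))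
          (λ eq → ℕ.<-irrefl (cong end eq) end<))

    midOf : ℕ → ℕ
    midOf s = mid (start s)

    midOf-order : ComputableOrder midOf
    midOf-order = order (app₁ mid mid-comp start-comp) mono
      (λ k → let n , k≤ = ComputableOrder.unbounded start-order k in n , ℕ.≤-trans k≤ (e≤mid _))
      where
      mono : ∀ s → midOf s ℕ.≤ midOf (suc s)
      mono s with step s
      ... | same eq _   = ℕ.≤-reflexive (cong mid (sym eq))
      -- The old middle index is at most the old end, which is the new start and so at most the new
      -- middle index.
      ... | next eq eq′ rewrite eq =
        ℕ.≤-trans (mid≤end (start s)) (ℕ.≤-trans (ℕ.≤-reflexive (sym eq′)) (e≤mid (suc s)))

    lowest highest : ℕ → ℕ
    lowest  s = argmin (suc (len (start s))) (start s)
    highest s = argmax (suc (len (start s))) (start s)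

    block-bounds : ∀ s {j} → s ℕ.≤ j → j ℕ.≤ suc s → a (lowest s) ℚ.≤ a j × a j ℚ.≤ a (highest s)
    block-bounds s s≤j j≤1+s =
      let e≤s , s<end = start-bounds s
          e≤j = ℕ.≤-trans e≤s s≤j
          j≤end = ℕ.≤-trans j≤1+s s<end
      in argmin-min (suc (len (start s))) (start s) e≤j j≤end ,
         argmax-max (suc (len (start s))) (start s) e≤j j≤end

    block-middle : ∀ s → Middle (a (lowest s)) (a (highest s)) (a (midOf s))
    block-middle s = mid-middle (start s)

    -- `D` will be `Slow α a`; here it is any relation that eventually holds along every computable
    -- order.
    module _ (D : ℕ → ℕ → Set)
             (D-order : ∀ {f} → ComputableOrder f → ∃[ N ] ∀ {s} → N ℕ.≤ s → D s (f s)) where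

      inside : ∀ s {j} → start s ℕ.≤ j → j ℕ.< end (start s) → midOf j ≡ midOf s
      inside s {j} e≤j j<end = cong mid (subst (λ i → start i ≡ start s) (ℕ.m∸n+n≡m e≤j)
        (start-block (start-idem s) (j ∸ start s)
          (subst (ℕ._< end (start s)) (sym (ℕ.m∸n+n≡m e≤j)) j<end)))

      -- The last index of a block starts the next one, so it is sent to the
      -- middle term by midOf ∘ pred rather than by midOf.
      D-mid : ∃[ N ] ∀ {s} → N ℕ.≤ s → ∀ {j} → start s ℕ.≤ j → j ℕ.≤ end (start s) →
              D j (midOf s)
      D-mid =
        let N₁ , D₁ = D-order midOf-order
            N₂ , D₂ = D-order (order-∘ midOf-order pred-order)
            N  , N≤ = ComputableOrder.unbounded start-order (N₁ ℕ.⊔ N₂)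
        in N , λ {s} N≤s {j} e≤j j≤end →
          let large = ℕ.≤-trans (ℕ.≤-trans N≤ (ComputableOrder.nondecreasing start-order N≤s)) e≤j
          in at-end s e≤j (D₁ (ℕ.m⊔n≤o⇒m≤o N₁ N₂ large)) (D₂ (ℕ.m⊔n≤o⇒n≤o N₁ N₂ large))
               (ℕ.m≤n⇒m<n∨m≡n j≤end)
        where
        at-end : ∀ s {j} → start s ℕ.≤ j → D j (midOf j) → D j (midOf (ℕ.pred j)) →
                 j ℕ.< end (start s) ⊎ j ≡ end (start s) → D j (midOf s)
        at-end s {j} e≤j D₁ D₂ (inj₁ j<end) = subst (D j) (inside s e≤j j<end) D₁
        at-end s     e≤j D₁ D₂ (inj₂ refl)  = subst (D (end (start s)))
          (inside s {ℕ.pred (end (start s))} (ℕ.<⇒≤pred (e<end (start s))) ℕ.≤-refl) D₂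

      block-estimates : ∃[ N ] ∀ {s} → N ℕ.≤ s →
        D (lowest s) (midOf s) × D (highest s) (midOf s)
      block-estimates = let N , D-mid′ = D-mid in N , λ {s} N≤s →
        let l≥ , l≤ = argmin-bounds (suc (len (start s))) (start s)
            h≥ , h≤ = argmax-bounds (suc (len (start s))) (start s)
        in D-mid′ N≤s l≥ l≤ , D-mid′ N≤s h≥ h≤

-- Linear inequalities between rationals

open CauchyEstimates

⟨_⟩ : ℕ → ℚ
⟨ n ⟩ = + n ℚ./ 1

-- A ratio of at least 3/4 suits `straddle`, because the middle half keeps a quarter of the width
-- from each end; 7/8 also leaves room in `jump-up` and `jump-down`.
ρ : ℚ
ρ = + 7 ℚ./ 8

dist-≥ : ∀ {p q} → q ℚ.≤ p → dist p q ≡ p ℚ.- q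
dist-≥ {p} {q} q≤p = ℚ.0≤p⇒∣p∣≡p
  (subst (ℚ._≤ p ℚ.- q) (ℚ.+-inverseʳ q) (ℚ.+-monoˡ-≤ (ℚ.- q) q≤p))

dist-≤ : ∀ {p q} → p ℚ.≤ q → dist p q ≡ q ℚ.- p
dist-≤ {p} {q} p≤q = trans (dist-comm p q) (dist-≥ p≤q)

diff≤dist : ∀ p q → p ℚ.- q ℚ.≤ dist p q
diff≤dist p q with ℚ.≤-total q p
... | inj₁ q≤p = ℚ.≤-reflexive (sym (dist-≥ q≤p))
... | inj₂ p≤q = ℚ.≤-trans (p≤q⇒p-q≤0 p≤q) (ℚ.0≤∣p∣ (p ℚ.- q))

diff≤dist′ : ∀ p q → q ℚ.- p ℚ.≤ dist p q
diff≤dist′ p q = subst (q ℚ.- p ℚ.≤_) (dist-comm q p) (diff≤dist q p)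

-- Contradictions are derived as strict sums of multiples of the hypotheses
-- whose two sides agree.

infixr 7 _·≤_ _·<_
infixl 6 _≤+≤_ _<+≤_ _<+<_ _≤+<_

_·≤_ : ∀ n {p q} → p ℚ.≤ q → ⟨ n ⟩ ℚ.* p ℚ.≤ ⟨ n ⟩ ℚ.* q
n ·≤ le = ℚ.*-monoˡ-≤-nonNeg ⟨ n ⟩ {{ℚ.normalize-nonNeg n 1}} le

_·<_ : ∀ n .{{_ : ℕ.NonZero n}} {p q} → p ℚ.< q → ⟨ n ⟩ ℚ.* p ℚ.< ⟨ n ⟩ ℚ.* q
n ·< lt = ℚ.*-monoʳ-<-pos ⟨ n ⟩ {{ℚ.normalize-pos n 1}} lt

_≤+≤_ = ℚ.+-mono-≤
_<+≤_ = ℚ.+-mono-<-≤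
_<+<_ = ℚ.+-mono-<
_≤+<_ = ℚ.+-mono-≤-<

absurd-< : ∀ {p q} → p ℚ.< q → p ≡ q → ⊥
absurd-< lt eq = ℚ.<-irrefl eq lt

-- Strictly below the middle half, multiplied by 4 as in `Middle`; `High` is the mirror image.
record Low (p q r : ℚ) : Set where
  constructor low
  field ineq : (r ℚ.+ r) ℚ.+ (r ℚ.+ r) ℚ.< q ℚ.+ (p ℚ.+ (p ℚ.+ p))

record High (p q r : ℚ) : Set where
  constructor high
  field ineq : p ℚ.+ (q ℚ.+ (q ℚ.+ q)) ℚ.< (r ℚ.+ r) ℚ.+ (r ℚ.+ r)

¬middle⇒ : ∀ p q r → ¬ Middle p q r → Low p q r ⊎ High p q r
¬middle⇒ p q r ¬mid with q ℚ.+ (p ℚ.+ (p ℚ.+ p)) ℚ.≤? (r ℚ.+ r) ℚ.+ (r ℚ.+ r)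
... | no  l≰ = inj₁ (low (ℚ.≰⇒> l≰))
... | yes l≤ with (r ℚ.+ r) ℚ.+ (r ℚ.+ r) ℚ.≤? p ℚ.+ (q ℚ.+ (q ℚ.+ q))
...   | no  u≰ = inj₂ (high (ℚ.≰⇒> u≰))
...   | yes u≤ = ⊥-elim (¬mid (middle l≤ u≤))

slow-≤ : ∀ {x p q} → ρ ℚ.* dist x p ℚ.≤ dist x q → ρ ℚ.* (x ℚ.- p) ℚ.≤ dist x q
slow-≤ {x} {p} le = ℚ.≤-trans (ℚ.*-monoˡ-≤-nonNeg ρ (diff≤dist x p)) le

slow-≥ : ∀ {x p q} → ρ ℚ.* dist x p ℚ.≤ dist x q → ρ ℚ.* (p ℚ.- x) ℚ.≤ dist x q
slow-≥ {x} {p} le = ℚ.≤-trans (ℚ.*-monoˡ-≤-nonNeg ρ (diff≤dist′ x p)) le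

-- If `c ≤ x`, slowness from `l` gives c ≤ l + (x - l)/8, which is below the middle half because x <
-- h. If `x ≤ c`, the same argument starts from `h`.
straddle : ∀ {x l h c} → l ℚ.< x → x ℚ.< h → Middle l h c →
           ρ ℚ.* dist x l ℚ.≤ dist x c → ρ ℚ.* dist x h ℚ.≤ dist x c → ⊥
straddle {x} {l} {h} {c} l<x x<h (middle lower upper) xl xh with ℚ.≤-total c x
... | inj₁ c≤x = absurd-<
  (8 ·≤ subst (ρ ℚ.* (x ℚ.- l) ℚ.≤_) (dist-≥ c≤x) (slow-≤ {x} {l} {c} xl)
    ≤+≤ 2 ·≤ lower ≤+< 2 ·< x<h <+< l<x)
  (solve 4 (λ x l h c →
     con ⟨ 8 ⟩ :* (con ρ :* (x :- l)) :+ con ⟨ 2 ⟩ :* (h :+ (l :+ (l :+ l))) :+ con ⟨ 2 ⟩ :* x :+ l :=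
     con ⟨ 8 ⟩ :* (x :- c) :+ con ⟨ 2 ⟩ :* ((c :+ c) :+ (c :+ c)) :+ con ⟨ 2 ⟩ :* h :+ x)
     refl x l h c)
  where open +-*-Solver
... | inj₂ x≤c = absurd-<
  (8 ·≤ subst (ρ ℚ.* (h ℚ.- x) ℚ.≤_) (dist-≤ x≤c) (slow-≥ {x} {h} {c} xh)
    ≤+≤ 2 ·≤ upper ≤+< 2 ·< l<x <+< x<h)
  (solve 4 (λ x l h c →
     con ⟨ 8 ⟩ :* (con ρ :* (h :- x)) :+ con ⟨ 2 ⟩ :* ((c :+ c) :+ (c :+ c)) :+ con ⟨ 2 ⟩ :* l :+ x :=
     con ⟨ 8 ⟩ :* (c :- x) :+ con ⟨ 2 ⟩ :* (l :+ (h :+ (h :+ h))) :+ con ⟨ 2 ⟩ :* x :+ h)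
     refl x l h c)
  where open +-*-Solver

module _ {x y v w l h δ : ℚ} (0<δ : 0ℚ ℚ.< δ) (gap : ⟨ 16 ⟩ ℚ.* δ ℚ.≤ h ℚ.- l)
         (x≤ : x ℚ.≤ y ℚ.+ δ) (≤x : y ℚ.≤ x ℚ.+ δ)
         (slow : ρ ℚ.* dist x v ℚ.≤ dist x w) where

  open +-*-Solver

  -- Let W = h - l, so δ ≤ W/16. Both `w` and `y` are in the top quarter and `x` is within δ of `y`,
  -- so |x - w| < W/4 + δ ≤ 5W/16, whereas x - v > W/2 - δ ≥ 7W/16. The ratio is thus below 5/7 < ρ.
  jump-up : Low l h v → High l h w → High l h y → w ℚ.≤ h → y ℚ.≤ h → ⊥
  jump-up (low v-low) (high w-high) (high y-high) w≤h y≤h with ℚ.≤-total w x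
  ... | inj₁ w≤x = absurd-<
    -- The multipliers cancel all variables; 204 = 13 · 16 - 4 takes up the remaining δ.
    (32 ·≤ subst (ρ ℚ.* (x ℚ.- v) ℚ.≤_) (dist-≥ w≤x) (slow-≤ {x} {v} {w} slow)
      ≤+≤ 4 ·≤ x≤ ≤+≤ 4 ·≤ y≤h ≤+≤ 13 ·≤ gap ≤+< 8 ·< w-high <+< 7 ·< v-low <+< 204 ·< 0<δ)
    (solve 7 (λ x y v w l h δ →
      con ⟨ 32 ⟩ :* (con ρ :* (x :- v)) :+ con ⟨ 4 ⟩ :* x :+ con ⟨ 4 ⟩ :* y :+
      con ⟨ 13 ⟩ :* (con ⟨ 16 ⟩ :* δ) :+ con ⟨ 8 ⟩ :* (l :+ (h :+ (h :+ h))) :+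
      con ⟨ 7 ⟩ :* ((v :+ v) :+ (v :+ v)) :+ con ⟨ 204 ⟩ :* con 0ℚ :=
      con ⟨ 32 ⟩ :* (x :- w) :+ con ⟨ 4 ⟩ :* (y :+ δ) :+ con ⟨ 4 ⟩ :* h :+
      con ⟨ 13 ⟩ :* (h :- l) :+ con ⟨ 8 ⟩ :* ((w :+ w) :+ (w :+ w)) :+
      con ⟨ 7 ⟩ :* (h :+ (l :+ (l :+ l))) :+ con ⟨ 204 ⟩ :* δ)
      refl x y v w l h δ)
  ... | inj₂ x≤w = absurd-<
    (32 ·≤ subst (ρ ℚ.* (x ℚ.- v) ℚ.≤_) (dist-≤ x≤w) (slow-≤ {x} {v} {w} slow)
      ≤+≤ 60 ·≤ ≤x ≤+≤ 32 ·≤ w≤h ≤+≤ 6 ·≤ gap ≤+< 15 ·< y-high <+< 7 ·< v-low <+< 36 ·< 0<δ)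
    (solve 7 (λ x y v w l h δ →
      con ⟨ 32 ⟩ :* (con ρ :* (x :- v)) :+ con ⟨ 60 ⟩ :* y :+ con ⟨ 32 ⟩ :* w :+
      con ⟨ 6 ⟩ :* (con ⟨ 16 ⟩ :* δ) :+ con ⟨ 15 ⟩ :* (l :+ (h :+ (h :+ h))) :+
      con ⟨ 7 ⟩ :* ((v :+ v) :+ (v :+ v)) :+ con ⟨ 36 ⟩ :* con 0ℚ :=
      con ⟨ 32 ⟩ :* (w :- x) :+ con ⟨ 60 ⟩ :* (x :+ δ) :+ con ⟨ 32 ⟩ :* h :+
      con ⟨ 6 ⟩ :* (h :- l) :+ con ⟨ 15 ⟩ :* ((y :+ y) :+ (y :+ y)) :+
      con ⟨ 7 ⟩ :* (h :+ (l :+ (l :+ l))) :+ con ⟨ 36 ⟩ :* δ)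
      refl x y v w l h δ)

  -- The reflection of `jump-up`, with the same multipliers.
  jump-down : High l h v → Low l h w → Low l h y → l ℚ.≤ w → l ℚ.≤ y → ⊥
  jump-down (high v-high) (low w-low) (low y-low) l≤w l≤y with ℚ.≤-total x w
  ... | inj₁ x≤w = absurd-<
    (32 ·≤ subst (ρ ℚ.* (v ℚ.- x) ℚ.≤_) (dist-≤ x≤w) (slow-≥ {x} {v} {w} slow)
      ≤+≤ 4 ·≤ ≤x ≤+≤ 4 ·≤ l≤y ≤+≤ 13 ·≤ gap ≤+< 8 ·< w-low <+< 7 ·< v-high <+< 204 ·< 0<δ)
    (solve 7 (λ x y v w l h δ →
      con ⟨ 32 ⟩ :* (con ρ :* (v :- x)) :+ con ⟨ 4 ⟩ :* y :+ con ⟨ 4 ⟩ :* l :+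
      con ⟨ 13 ⟩ :* (con ⟨ 16 ⟩ :* δ) :+ con ⟨ 8 ⟩ :* ((w :+ w) :+ (w :+ w)) :+
      con ⟨ 7 ⟩ :* (l :+ (h :+ (h :+ h))) :+ con ⟨ 204 ⟩ :* con 0ℚ :=
      con ⟨ 32 ⟩ :* (w :- x) :+ con ⟨ 4 ⟩ :* (x :+ δ) :+ con ⟨ 4 ⟩ :* y :+
      con ⟨ 13 ⟩ :* (h :- l) :+ con ⟨ 8 ⟩ :* (h :+ (l :+ (l :+ l))) :+
      con ⟨ 7 ⟩ :* ((v :+ v) :+ (v :+ v)) :+ con ⟨ 204 ⟩ :* δ)
      refl x y v w l h δ)
  ... | inj₂ w≤x = absurd-<
    (32 ·≤ subst (ρ ℚ.* (v ℚ.- x) ℚ.≤_) (dist-≥ w≤x) (slow-≥ {x} {v} {w} slow)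
      ≤+≤ 60 ·≤ x≤ ≤+≤ 32 ·≤ l≤w ≤+≤ 6 ·≤ gap ≤+< 15 ·< y-low <+< 7 ·< v-high <+< 36 ·< 0<δ)
    (solve 7 (λ x y v w l h δ →
      con ⟨ 32 ⟩ :* (con ρ :* (v :- x)) :+ con ⟨ 60 ⟩ :* x :+ con ⟨ 32 ⟩ :* l :+
      con ⟨ 6 ⟩ :* (con ⟨ 16 ⟩ :* δ) :+ con ⟨ 15 ⟩ :* ((y :+ y) :+ (y :+ y)) :+
      con ⟨ 7 ⟩ :* (l :+ (h :+ (h :+ h))) :+ con ⟨ 36 ⟩ :* con 0ℚ :=
      con ⟨ 32 ⟩ :* (x :- w) :+ con ⟨ 60 ⟩ :* (y :+ δ) :+ con ⟨ 32 ⟩ :* w :+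
      con ⟨ 6 ⟩ :* (h :- l) :+ con ⟨ 15 ⟩ :* (h :+ (l :+ (l :+ l))) :+
      con ⟨ 7 ⟩ :* ((v :+ v) :+ (v :+ v)) :+ con ⟨ 36 ⟩ :* δ)
      refl x y v w l h δ)

≤-gap⇒< : ∀ {l h δ} → 0ℚ ℚ.< δ → ⟨ 16 ⟩ ℚ.* δ ℚ.≤ h ℚ.- l → l ℚ.< h
≤-gap⇒< {l} {h} {δ} 0<δ gap = ℚ.≰⇒> λ h≤l → absurd-<
  (16 ·< 0<δ <+≤ gap <+≤ h≤l)
  (solve 3 (λ l h δ → con ⟨ 16 ⟩ :* con 0ℚ :+ con ⟨ 16 ⟩ :* δ :+ h :=
                      con ⟨ 16 ⟩ :* δ :+ (h :- l) :+ l) refl l h δ)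
  where open +-*-Solver

low-l : ∀ {l h} → l ℚ.< h → Low l h l
low-l {l} {h} l<h = low (ℚ.≰⇒> λ le → absurd-< (l<h <+≤ le)
  (solve 2 (λ l h → l :+ (h :+ (l :+ (l :+ l))) := h :+ ((l :+ l) :+ (l :+ l))) refl l h))
  where open +-*-Solver

high-h : ∀ {l h} → l ℚ.< h → High l h h
high-h {l} {h} l<h = high (ℚ.≰⇒> λ le → absurd-< (l<h <+≤ le)
  (solve 2 (λ l h → l :+ ((h :+ h) :+ (h :+ h)) := h :+ (l :+ (h :+ (h :+ h)))) refl l h))
  where open +-*-Solver

¬low×high : ∀ {l h r} → l ℚ.< h → Low l h r → High l h r → ⊥
¬low×high {l} {h} {r} l<h (low lt) (high gt) = absurd-< (2 ·< l<h <+< lt <+< gt)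
  (solve 3 (λ l h r → con ⟨ 2 ⟩ :* l :+ ((r :+ r) :+ (r :+ r)) :+ (l :+ (h :+ (h :+ h))) :=
                      con ⟨ 2 ⟩ :* h :+ (h :+ (l :+ (l :+ l))) :+ ((r :+ r) :+ (r :+ r)))
    refl l h r)
  where open +-*-Solver

p-q≤r⇒p≤q+r : ∀ {p q r} → p ℚ.- q ℚ.≤ r → p ℚ.≤ q ℚ.+ r
p-q≤r⇒p≤q+r {p} {q} {r} le = subst (ℚ._≤ q ℚ.+ r)
  (solve 2 (λ p q → q :+ (p :- q) := p) refl p q) (ℚ.+-monoʳ-≤ q le)
  where open +-*-Solver

dist-≤-width : ∀ {p q l h} → l ℚ.≤ p → p ℚ.≤ h → l ℚ.≤ q → q ℚ.≤ h → dist p q ℚ.≤ h ℚ.- l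
dist-≤-width {p} {q} l≤p p≤h l≤q q≤h with ℚ.≤-total q p
... | inj₁ q≤p = ℚ.≤-trans (ℚ.≤-reflexive (dist-≥ q≤p)) (ℚ.+-mono-≤ p≤h (ℚ.neg-antimono-≤ l≤q))
... | inj₂ p≤q = ℚ.≤-trans (ℚ.≤-reflexive (dist-≤ p≤q)) (ℚ.+-mono-≤ q≤h (ℚ.neg-antimono-≤ l≤p))

-- The triangle inequality uses up one of the 17 multiples of δ.
spread : ∀ x p q {δ} → ⟨ 17 ⟩ ℚ.* δ ℚ.≤ dist x p → dist x q ℚ.≤ δ → ⟨ 16 ⟩ ℚ.* δ ℚ.≤ dist q p
spread x p q {δ} 17δ≤ ≤δ = ℚ.≮⇒≥ λ lt → absurd-< (17δ≤ ≤+≤ triangle ≤+≤ ≤δ ≤+< lt)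
  (solve 4 (λ δ u v w →
     con ⟨ 17 ⟩ :* δ :+ u :+ v :+ w := u :+ (v :+ w) :+ δ :+ con ⟨ 16 ⟩ :* δ)
     refl δ (dist x p) (dist x q) (dist q p))
  where
  open +-*-Solver
  triangle : dist x p ℚ.≤ dist x q ℚ.+ dist q p
  triangle = subst (λ r → ℚ.∣ r ∣ ℚ.≤ dist x q ℚ.+ dist q p)
    (solve 3 (λ x p q → (x :- q) :+ (q :- p) := x :- p) refl x p q)
    (ℚ.∣p+q∣≤∣p∣+∣q∣ (x ℚ.- q) (q ℚ.- p))

-- A discrete intermediate value argument: walk forward from `i` until the successor is classified
-- as `Q`. Disjointness at the last index prevents the walk from arriving there still in `P`.
switch : ∀ {P Q : ℕ → Set} d i → (∀ {j} → i ℕ.≤ j → j ℕ.≤ d + i → P j ⊎ Q j) →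
         P i → Q (d + i) → ¬ (P (d + i) × Q (d + i)) →
         ∃[ u ] (i ℕ.≤ u × u ℕ.< d + i × P u × Q (suc u))
switch zero    i split Pi Qi disjoint = ⊥-elim (disjoint (Pi , Qi))
switch {P} {Q} (suc d) i split Pi Qd disjoint with split (ℕ.n≤1+n i) (ℕ.s≤s (ℕ.m≤n+m i d))
... | inj₂ Qsi = i , ℕ.≤-refl , ℕ.s≤s (ℕ.m≤n+m i d) , Pi , Qsi
... | inj₁ Psi rewrite sym (ℕ.+-suc d i) =
  let u , i<u , u<t , Pu , Qu = switch d (suc i) (λ le → split (ℕ.<⇒≤ le)) Psi Qd disjoint
  in u , ℕ.<⇒≤ i<u , u<t , Pu , Qu

-- Approximations that no order speeds up

Eventually : (ℕ → Set) → Set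
Eventually P = ∃[ N ] ∀ {n} → N ℕ.≤ n → P n

both : ∀ {P Q R : ℕ → Set} → (∀ {n} → P n → Q n → R n) →
       Eventually P → Eventually Q → Eventually R
both f (M , p) (N , q) = M ⊔ N , λ le → f (p (≤ˡ le)) (q (≤ʳ {M} le))

eventually : ∀ {P : ℕ → Set} → Eventually P → ∃[ n ] P n
eventually (N , p) = N , p ℕ.≤-refl

-- A termwise form of ρ|α - a_s| ≤ |α - a_t|: at a common late index, several such facts become
-- inequalities in ℚ.
Slow : ℝ → (ℕ → ℚ) → ℕ → ℕ → Set
Slow α a s t = Eventually λ n → ρ ℚ.* dist (seq α n) (a s) ℚ.≤ dist (seq α n) (a t)

module _ (em : ExcludedMiddle 0ℓ) (α : ℝ) (irr : Irrational α) where

  away : ∀ q → Σ[ ε ∈ ℚ ] 0ℚ ℚ.< ε × Eventually λ n → ε ℚ.≤ dist (seq α n) q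
  away q = InverseEstimates.#0⇒away (α - fromℚ q) (#⇒-#0 α (fromℚ q) (irr q))

  close : ∀ {a} → a ConvergesTo α → ∀ ε → 0ℚ ℚ.< ε →
          ∃[ T ] ∀ {s} → T ℕ.≤ s → Eventually λ n → dist (seq α n) (a s) ℚ.≤ ε
  close {a} conv ε 0<ε =
    let T , h = conv ε 0<ε
    in T , λ {s} T≤s →
      let ε′ , 0<ε′ , N , le = h T≤s
      in N , λ {n} N≤n → ℚ.≤-trans (ℚ.≤-trans
           (ℚ.≤-reflexive (sym (ℚ.+-identityʳ (dist (seq α n) (a s)))))
           (ℚ.+-monoʳ-≤ (dist (seq α n) (a s)) (ℚ.<⇒≤ 0<ε′)))
           (le N≤n)

  -- Without a middle term, the block e , … , t would jump from one of the
  -- clusters Low and High to the other, which contains a t and hence α.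
  module Settled {a} (ca : Computableℚ a) (slow : ∀ s → Slow α a s (suc s)) (e T : ℕ)
    {δ} (0<δ : 0ℚ ℚ.< δ)
    (far  : Eventually λ n → ⟨ 17 ⟩ ℚ.* δ ℚ.≤ dist (seq α n) (a e))
    (near : Eventually λ n → dist (seq α n) (a (suc T + e)) ℚ.≤ δ) where

    open Blocks a ca

    t : ℕ
    t = suc T + e

    y l h : ℚ
    y = a t
    l = a (argmin (suc T) e)
    h = a (argmax (suc T) e)

    l≤ : ∀ {j} → e ℕ.≤ j → j ℕ.≤ t → l ℚ.≤ a j
    l≤ = argmin-min (suc T) e

    ≤h : ∀ {j} → e ℕ.≤ j → j ℕ.≤ t → a j ℚ.≤ h
    ≤h = argmax-max (suc T) e

    e≤t : e ℕ.≤ t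
    e≤t = ℕ.m≤n+m e (suc T)

    gap : ⟨ 16 ⟩ ℚ.* δ ℚ.≤ h ℚ.- l
    gap = let n , δ≤ , ≤δ = eventually (both _,_ far near)
          in ℚ.≤-trans (spread (seq α n) (a e) y δ≤ ≤δ)
            (dist-≤-width (l≤ e≤t ℕ.≤-refl) (≤h e≤t ℕ.≤-refl) (l≤ ℕ.≤-refl e≤t) (≤h ℕ.≤-refl e≤t))

    l<h : l ℚ.< h
    l<h = ≤-gap⇒< 0<δ gap

    Found : Set
    Found = ∃[ j ] j ℕ.≤ suc T × MidTerm (suc T) e j

    module _ (none : ¬ Found) where

      classify : ∀ {j} → e ℕ.≤ j → j ℕ.≤ t → Low l h (a j) ⊎ High l h (a j)
      classify {j} e≤j j≤t = ¬middle⇒ l h (a j) λ mid → none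
        ( j ∸ e
        , ℕ.≤-trans (ℕ.∸-monoˡ-≤ e j≤t) (ℕ.≤-reflexive (ℕ.m+n∸n≡m (suc T) e))
        , subst (λ i → Middle l h (a i)) (sym (ℕ.m∸n+n≡m e≤j)) mid )

      no-jump-up : ∀ {u} → e ℕ.≤ u → u ℕ.< t → Low l h (a u) → High l h (a (suc u)) → ¬ High l h y
      no-jump-up {u} e≤u u<t u-low v-high y-high =
        let n , ≤δ , sl = eventually (both _,_ near (slow u))
        in jump-up {seq α n} {y} {a u} {a (suc u)} {l} {h} 0<δ gap
        (p-q≤r⇒p≤q+r {seq α n} {y} (ℚ.≤-trans (diff≤dist (seq α n) y) ≤δ))
        (p-q≤r⇒p≤q+r {y} {seq α n} (ℚ.≤-trans (diff≤dist′ (seq α n) y) ≤δ))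
        sl u-low v-high y-high (≤h (ℕ.m≤n⇒m≤1+n e≤u) u<t) (≤h e≤t ℕ.≤-refl)

      no-jump-down : ∀ {u} → e ℕ.≤ u → u ℕ.< t → High l h (a u) → Low l h (a (suc u)) → ¬ Low l h y
      no-jump-down {u} e≤u u<t u-high v-low y-low =
        let n , ≤δ , sl = eventually (both _,_ near (slow u))
        in jump-down {seq α n} {y} {a u} {a (suc u)} {l} {h} 0<δ gap
        (p-q≤r⇒p≤q+r {seq α n} {y} (ℚ.≤-trans (diff≤dist (seq α n) y) ≤δ))
        (p-q≤r⇒p≤q+r {y} {seq α n} (ℚ.≤-trans (diff≤dist′ (seq α n) y) ≤δ))
        sl u-high v-low y-low (l≤ (ℕ.m≤n⇒m≤1+n e≤u) u<t) (l≤ e≤t ℕ.≤-refl)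

      switch-from : ∀ {P Q : ℚ → Set} → (∀ {j} → e ℕ.≤ j → j ℕ.≤ t → P (a j) ⊎ Q (a j)) →
        ∀ {i} → e ℕ.≤ i → i ℕ.≤ t → P (a i) → Q y → ¬ (P y × Q y) →
        ∃[ u ] (i ℕ.≤ u × u ℕ.< t × P (a u) × Q (a (suc u)))
      switch-from {P} {Q} split {i} e≤i i≤t Pi Qy disjoint = subst
        (λ t → (∀ {j} → i ℕ.≤ j → j ℕ.≤ t → P (a j) ⊎ Q (a j)) → Q (a t) → ¬ (P (a t) × Q (a t)) →
               ∃[ u ] (i ℕ.≤ u × u ℕ.< t × P (a u) × Q (a (suc u))))
        (ℕ.m∸n+n≡m i≤t)
        (λ split → switch {P ∘ a} {Q ∘ a} (t ∸ i) i split Pi)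
        (λ i≤j → split (ℕ.≤-trans e≤i i≤j)) Qy disjoint

      -- The maximum of the window lies in the upper cluster, so a last term in the lower one forces
      -- a jump down somewhere in between.
      y-low-absurd : ¬ Low l h y
      y-low-absurd y-low =
        let e≤i , i≤t = argmax-bounds (suc T) e
            u , i≤u , u<t , u-high , v-low = switch-from {High l h} {Low l h}
              (λ p q → [ inj₂ , inj₁ ]′ (classify p q)) e≤i i≤t (high-h l<h) y-low
              (λ (p , q) → ¬low×high l<h q p)
        in no-jump-down (ℕ.≤-trans e≤i i≤u) u<t u-high v-low y-low

      y-high-absurd : ¬ High l h y
      y-high-absurd y-high =
        let e≤i , i≤t = argmin-bounds (suc T) e
            u , i≤u , u<t , u-low , v-high = switch-from {Low l h} {High l h}
              classify e≤i i≤t (low-l l<h) y-high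
              (λ (p , q) → ¬low×high l<h p q)
        in no-jump-up (ℕ.≤-trans e≤i i≤u) u<t u-low v-high y-high

    -- This classical witness only shows that the search for the end of a block terminates; the
    -- search itself is computable by minimisation.
    search : Found
    search = decidable-stable em λ none →
      [ y-low-absurd none , y-high-absurd none ]′ (classify none e≤t ℕ.≤-refl)

  middle-exists : ∀ {a} (ca : Computableℚ a) → a ConvergesTo α → (∀ s → Slow α a s (suc s)) →
    ∀ e → ∃[ k ] ∃[ j ] j ℕ.≤ suc k × Blocks.MidTerm a ca (suc k) e j
  middle-exists {a} ca conv slow e =
    let ε , 0<ε , far = away (a e)
        -- With 17δ = ε, the term `a e` is at least 17δ from α and late terms are within δ of it,
        -- which leaves the gap 16δ.
        δ , 0<δ , 17δ≡ε = quotient ⟨ 17 ⟩ ε (ℚ.positive⁻¹ ⟨ 17 ⟩) 0<ε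
        T , near = close conv δ 0<δ
    in T , Settled.search ca slow e T 0<δ
             (subst (λ ε → Eventually λ n → ε ℚ.≤ dist (seq α n) (a e)) (sym 17δ≡ε) far)
             (near (ℕ.≤-trans (ℕ.n≤1+n T) (ℕ.m≤m+n (suc T) e)))

-- Crossings of the limit

Below Above : ℝ → ℚ → Set
Below α q = Eventually λ n → q ℚ.< seq α n
Above α q = Eventually λ n → seq α n ℚ.< q

side : ∀ α q → α # fromℚ q → Below α q ⊎ Above α q
side α q (inj₁ (ε , 0<ε , N , h)) = inj₂ (N , λ {n} N≤n → ℚ.<-≤-trans
  (subst (ℚ._< seq α n ℚ.+ ε) (ℚ.+-identityʳ (seq α n)) (ℚ.+-monoʳ-< (seq α n) 0<ε)) (h N≤n))
side α q (inj₂ (ε , 0<ε , N , h)) = inj₁ (N , λ N≤n → ℚ.<-≤-trans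
  (subst (ℚ._< q ℚ.+ ε) (ℚ.+-identityʳ q) (ℚ.+-monoʳ-< q 0<ε)) (h N≤n))

-- Meant for running extremes, which lie between the newest term and α and hence are no farther from
-- α than that term.
converges-closer : ∀ {α a b} M → a ConvergesTo α →
  (∀ k → Eventually λ n → dist (seq α n) (b k) ℚ.≤ dist (seq α n) (a (k + M))) →
  b ConvergesTo α
converges-closer {α} {a} {b} M conv closer ε 0<ε =
  let N , h = conv ε 0<ε
  in N , λ {k} N≤k →
    let ε′ , 0<ε′ , N′ , le = h (ℕ.≤-trans N≤k (ℕ.m≤m+n k M))
    in ε′ , 0<ε′ , both (λ p q → ℚ.≤-trans (ℚ.+-monoˡ-≤ ε′ p) q) (closer k) (N′ , le)

dist-between : ∀ {x p q} → p ℚ.≤ q → q ℚ.< x → dist x q ℚ.≤ dist x p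
dist-between {x} {p} {q} p≤q q<x = subst (ℚ._≤ dist x p) (sym (dist-≥ (ℚ.<⇒≤ q<x)))
  (ℚ.≤-trans (ℚ.+-monoʳ-≤ x (ℚ.neg-antimono-≤ p≤q)) (diff≤dist x p))

dist-between′ : ∀ {x p q} → q ℚ.≤ p → x ℚ.< q → dist x q ℚ.≤ dist x p
dist-between′ {x} {p} {q} q≤p x<q = subst (ℚ._≤ dist x p) (sym (dist-≤ (ℚ.<⇒≤ x<q)))
  (ℚ.≤-trans (ℚ.+-monoˡ-≤ (ℚ.- x) q≤p) (diff≤dist′ x p))

module OneSided {α a} (approx : ComputableApproximation a α) (M : ℕ) where

  open Approximation (proj₁ approx)
  open Blocks a (proj₂ approx)

  leftCE : (∀ {s} → M ℕ.≤ s → Below α (a s)) → LeftCE α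
  leftCE below = (λ k → a (argmax k M)) ,
    (record
      { lower     = λ k → lower (argmax k M)
      ; upper     = λ k → upper (argmax k M)
      ; converges = converges-closer {α} {a} {λ k → a (argmax k M)} M converges λ k →
          let N , lt = below (proj₁ (argmax-bounds k M))
          in N , λ N≤n → dist-between (argmax-last k M) (lt N≤n)
      } ,
     reindex (proj₂ approx) (app₂ argmax argmax-comp (var 0F) (const-comp M))) ,
    λ s≤t → argmax-mono M (ℕ.≤⇒≤′ s≤t)

  rightCE : (∀ {s} → M ℕ.≤ s → Above α (a s)) → RightCE α
  rightCE above = (λ k → a (argmin k M)) ,
    (record
      { lower     = λ k → lower (argmin k M)
      ; upper     = λ k → upper (argmin k M)
      ; converges = converges-closer {α} {a} {λ k → a (argmin k M)} M converges λ k →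
          let N , lt = above (proj₁ (argmin-bounds k M))
          in N , λ N≤n → dist-between′ (argmin-last k M) (lt N≤n)
      } ,
     reindex (proj₂ approx) (app₂ argmin argmin-comp (var 0F) (const-comp M))) ,
    λ s≤t → argmin-anti M (ℕ.≤⇒≤′ s≤t)

-- `i` and `j` are `s` and `suc s` in either order, so upward and downward crossings share one form.
record Crossing (α : ℝ) (a : ℕ → ℚ) (s : ℕ) : Set where
  constructor crossing
  field
    {i j}   : ℕ
    i-range : s ℕ.≤ i × i ℕ.≤ suc s
    j-range : s ℕ.≤ j × j ℕ.≤ suc s
    i-below : Below α (a i)
    j-above : Above α (a j)

module _ (em : ExcludedMiddle 0ℓ) {α : ℝ} (irr : Irrational α) where

  -- Without crossings from `M` on, every later term inherits the side of α on which `a M` lies,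
  -- making α left-c.e. or right-c.e.
  crossings : ∀ {a} → ComputableApproximation a α → ¬ LeftCE α → ¬ RightCE α →
              ∀ M → ∃[ s ] M ℕ.≤ s × Crossing α a s
  crossings {a} approx ¬left ¬right M = decidable-stable em λ none →
    let below-suc : ∀ {s} → M ℕ.≤ s → Below α (a s) → Below α (a (suc s))
        below-suc {s} M≤s b = [ (λ b′ → b′) , (λ a′ → ⊥-elim (none
          (s , M≤s , crossing (ℕ.≤-refl , ℕ.n≤1+n s) (ℕ.n≤1+n s , ℕ.≤-refl) b a′))) ]′
          (side α (a (suc s)) (irr (a (suc s))))
        above-suc : ∀ {s} → M ℕ.≤ s → Above α (a s) → Above α (a (suc s))
        above-suc {s} M≤s b = [ (λ b′ → ⊥-elim (none
          (s , M≤s , crossing (ℕ.n≤1+n s , ℕ.≤-refl) (ℕ.≤-refl , ℕ.n≤1+n s) b′ b))) , (λ a′ → a′) ]′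
          (side α (a (suc s)) (irr (a (suc s))))
    in [ (λ b → ¬left  (OneSided.leftCE approx M (λ M≤s → up (λ s → Below α (a s)) below-suc b (ℕ.≤⇒≤′ M≤s))))
       , (λ b → ¬right (OneSided.rightCE approx M (λ M≤s → up (λ s → Above α (a s)) above-suc b (ℕ.≤⇒≤′ M≤s)))) ]′
       (side α (a M) (irr (a M)))
    where
    up : (P : ℕ → Set) → (∀ {s} → M ℕ.≤ s → P s → P (suc s)) → P M →
         ∀ {s} → M ℕ.≤′ s → P s
    up P step PM ℕ.≤′-refl       = PM
    up P step PM (ℕ.≤′-step M≤s) = step (ℕ.≤′⇒≤ M≤s) (up P step PM M≤s)

  AlwaysSlow : (ℕ → ℚ) → Set
  AlwaysSlow a = ∀ {f} → ComputableOrder f → ∃[ N ] ∀ {s} → N ℕ.≤ s → Slow α a s (f s)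

  -- A late crossing has both its terms in the window of one block, so the extremes of that window
  -- straddle α, while both are slow towards the middle term.
  no-slow-crossings : ∀ {a} → Computableℚ a → a ConvergesTo α → (∀ s → Slow α a s (suc s)) →
         AlwaysSlow a → (∀ M → ∃[ s ] M ℕ.≤ s × Crossing α a s) → ⊥
  no-slow-crossings {a} ca conv slow always cross =
    let N , estimates = block-estimates middle-term (Slow α a) always
        s , N≤s , crossing (s≤i , i≤) (s≤j , j≤) below above = cross N
        low-slow , high-slow = estimates N≤s
        n , (l<x , x<h) , (xl , xh) = eventually (both _,_ (both _,_ below above) (both _,_ low-slow high-slow))
    in straddle
         (ℚ.≤-<-trans (proj₁ (block-bounds middle-term s s≤i i≤)) l<x)
         (ℚ.<-≤-trans x<h (proj₂ (block-bounds middle-term s s≤j j≤)))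
         (block-middle middle-term s) xl xh
    where
    open Blocks a ca
    middle-term = middle-exists em α irr ca conv slow

  -- An order f for the shifted sequence acts on the original one as i ↦ f (i ∸ N) + N, again a
  -- computable order.
  shift-slow : ∀ {a} N → AlwaysSlow a → AlwaysSlow (λ s → a (s + N))
  shift-slow {a} N always {f} F =
    let M , h = always (order-∘ (order-∘ plus F) minus)
    in M , λ {s} M≤s → subst (λ i → Slow α a (s + N) (f i + N)) (ℕ.m+n∸n≡m s N)
         (h (ℕ.≤-trans M≤s (ℕ.m≤m+n s N)))
    where
    plus : ComputableOrder (_+ N)
    plus = order (var 0F ⊕ const-comp N) (λ n → ℕ.n≤1+n (n + N)) (λ k → k , ℕ.m≤m+n k N)
    minus : ComputableOrder (_∸ N)
    minus = order (var 0F ⊝ const-comp N) (λ n → ℕ.∸-monoˡ-≤ N (ℕ.n≤1+n n))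
      (λ k → k + N , ℕ.≤-reflexive (sym (ℕ.m+n∸n≡m k N)))

  ¬always-slow : ∀ {a} → ComputableApproximation a α → ¬ LeftCE α → ¬ RightCE α → ¬ AlwaysSlow a
  ¬always-slow {a} approx ¬left ¬right always =
    -- Slowness of `suc` holds only from some `N` on; dropping the first `N` terms makes it hold
    -- everywhere, as `middle-exists` requires.
    let N , slow = always suc-order
    in no-slow-crossings (reindex (proj₂ approx) (var 0F ⊕ const-comp N))
         (λ ε 0<ε → let T , h = Approximation.converges (proj₁ approx) ε 0<ε
                    in T , λ {s} T≤s → h (ℕ.≤-trans T≤s (ℕ.m≤m+n s N)))
         (λ s → slow (ℕ.m≤n+m N s))
         (shift-slow {a} N always)
         (λ M → let s , M+N≤s , cr = crossings approx ¬left ¬right (M + N)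
                in s ∸ N , subst (ℕ._≤ s ∸ N) (ℕ.m+n∸n≡m M N) (ℕ.∸-monoˡ-≤ N M+N≤s) ,
                   shift-crossing N (ℕ.≤-trans (ℕ.m≤n+m N M) M+N≤s) cr)
    where
    shift-crossing : ∀ N {s} → N ℕ.≤ s → Crossing α a s → Crossing α (λ s → a (s + N)) (s ∸ N)
    shift-crossing N {s} N≤s (crossing {i} {j} (s≤i , i≤) (s≤j , j≤) b a′) =
      crossing (range s≤i i≤) (range s≤j j≤)
        (subst (Below α ∘ a) (sym (ℕ.m∸n+n≡m (ℕ.≤-trans N≤s s≤i))) b)
        (subst (Above α ∘ a) (sym (ℕ.m∸n+n≡m (ℕ.≤-trans N≤s s≤j))) a′)
      where
      range : ∀ {i} → s ℕ.≤ i → i ℕ.≤ suc s → s ∸ N ℕ.≤ i ∸ N × i ∸ N ℕ.≤ suc (s ∸ N)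
      range {i} s≤i i≤ = ℕ.∸-monoˡ-≤ N s≤i ,
        subst (i ∸ N ℕ.≤_) (ℕ.+-∸-assoc 1 N≤s) (ℕ.∸-monoˡ-≤ N i≤)

-- From real numbers to rational estimates

¬#⇒≃ : ∀ α q → ¬ α # fromℚ q → α ≃ fromℚ q
¬#⇒≃ α q ¬α#q ε 0<ε =
  let N , close = cauchy α (½ ℚ.* ε) (half 0<ε)
  in N , λ {n} N≤n → ℚ.≰⇒> λ ε≤ → ¬α#q (apart N close n N≤n ε≤)
  where
  open +-*-Solver
  -- Past the Cauchy threshold for ε/2, one term at distance ε from `q` keeps all later terms at
  -- least ε/2 away on the same side.
  apart : ∀ N → (∀ {m n} → N ℕ.≤ m → N ℕ.≤ n → dist (seq α m) (seq α n) ℚ.< ½ ℚ.* ε) →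
          ∀ n → N ℕ.≤ n → ε ℚ.≤ dist (seq α n) q → α # fromℚ q
  apart N close n N≤n ε≤ = [ above , below ]′ (ℚ.≤-total q (seq α n))
    where
    x = seq α n
    above : q ℚ.≤ x → α # fromℚ q
    above q≤x = inj₂ (½ ℚ.* ε , half 0<ε , N , λ {m} N≤m → ℚ.≮⇒≥ λ lt → absurd-<
      (lt <+≤ subst (ε ℚ.≤_) (dist-≥ q≤x) ε≤ <+<
       ℚ.≤-<-trans (diff≤dist′ (seq α m) x) (close N≤m N≤n))
      (solve 4 (λ y q x ε → y :+ ε :+ (x :- y) := q :+ con ½ :* ε :+ (x :- q) :+ con ½ :* ε)
        refl (seq α m) q x ε))
    below : x ℚ.≤ q → α # fromℚ q
    below x≤q = inj₁ (½ ℚ.* ε , half 0<ε , N , λ {m} N≤m → ℚ.≮⇒≥ λ lt → absurd-<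
      (lt <+≤ subst (ε ℚ.≤_) (dist-≤ x≤q) ε≤ <+<
       ℚ.≤-<-trans (diff≤dist (seq α m) x) (close N≤m N≤n))
      (solve 4 (λ y q x ε → q :+ ε :+ (y :- x) := y :+ con ½ :* ε :+ (q :- x) :+ con ½ :* ε)
        refl (seq α m) q x ε))

-- One late term of `r` below `p` would keep all later terms of `r` at least ε/2 below those of `b`,
-- giving `r < b`.
eventually-above : ∀ p {b r} → fromℚ p < b → b ≤ r → Eventually λ n → p ℚ.≤ seq r n
eventually-above p {b} {r} (ε , 0<ε , M , p+ε≤b) b≤r =
  let N , close = cauchy r (½ ℚ.* ε) (half 0<ε)
  in M ⊔ N , λ {n} le → ℚ.≮⇒≥ λ r<p → b≤r
       ( ½ ℚ.* ε , half 0<ε , M ⊔ N , λ {m} le′ → ℚ.≮⇒≥ λ lt → absurd-<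
           (lt <+≤ p+ε≤b (≤ˡ le′) <+< r<p <+<
            ℚ.≤-<-trans (diff≤dist (seq r m) (seq r n)) (close (≤ʳ {M} le′) (≤ʳ {M} le)))
           (solve 5 (λ b p ε y z → b :+ (p :+ ε) :+ z :+ (y :- z) :=
                                   y :+ con ½ :* ε :+ b :+ p :+ con ½ :* ε)
             refl (seq b m) p ε (seq r m) (seq r n)) )
  where open +-*-Solver

ratio⇒ : ∀ {u v} → v ≢ 0ℚ → ρ ℚ.≤ ℚ.∣ u ℚ.* inv v ∣ → ρ ℚ.* ℚ.∣ v ∣ ℚ.≤ ℚ.∣ u ∣
ratio⇒ {u} {v} v≢0 le = begin
  ρ ℚ.* ℚ.∣ v ∣                   ≤⟨ ℚ.*-monoʳ-≤-nonNeg ℚ.∣ v ∣ {{ℚ.∣-∣-nonNeg v}} le ⟩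
  ℚ.∣ u ℚ.* inv v ∣ ℚ.* ℚ.∣ v ∣   ≡⟨ ℚ.∣p*q∣≡∣p∣*∣q∣ (u ℚ.* inv v) v ⟨
  ℚ.∣ u ℚ.* inv v ℚ.* v ∣         ≡⟨ cong ℚ.∣_∣ (trans (ℚ.*-assoc u (inv v) v)
                                       (trans (cong (u ℚ.*_) (inv-inverse v v≢0)) (ℚ.*-identityʳ u))) ⟩
  ℚ.∣ u ∣                         ∎
  where open ℚ.≤-Reasoning

module _ (em : ExcludedMiddle 0ℓ) where

  irrational : ∀ {α} → ¬ Rational α → Irrational α
  irrational {α} ¬rat q = decidable-stable em λ ¬α#q → ¬rat (q , ¬#⇒≃ α q ¬α#q)

  -- By contraposition: an eventual lower bound b > ρ for the ratios makes late terms of each late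
  -- ratio at least ρ, so f would be eventually slow.
  not-slow⇒liminf : ∀ {α} (irr : Irrational α) a f → ¬ (∃[ N ] ∀ {s} → N ℕ.≤ s → Slow α a s (f s)) →
                    LimInf speedupRatio α irr a f ≤ fromℚ ρ
  not-slow⇒liminf {α} irr a f ¬slow b (N , b≤ratio) ρ<b = ¬slow (N , λ {s} N≤s →
    -- A positive distance from `a s` keeps late denominators off 0, where `inv` has its junk value.
    let ε , 0<ε , far = away em α irr (a s)
    in both (λ {n} ρ≤ ε≤ → ratio⇒ {seq α n ℚ.- a (f s)} {seq α n ℚ.- a s}
               (InverseEstimates.away⇒≢0 {ε} {seq α n ℚ.- a s} 0<ε ε≤) ρ≤)
         (eventually-above ρ {b} {speedupRatio α irr a f s} ρ<b (b≤ratio N≤s)) far)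

  -- If `a` were not ρ-speedable, α would be irrational and every computable order eventually slow,
  -- against `¬always-slow`.
  speedable : ∀ {α} a → ComputableApproximation a α → ¬ LeftCE α → ¬ RightCE α → Speedable a α
  speedable {α} a approx ¬left ¬right =
    ρ , ℚ.nonNegative⁻¹ ρ , ℚ.*<* (ℤ.+<+ (ℕ.s≤s ℕ.≤-refl)) , decidable-stable em λ ¬speedable →
      let irr = irrational {α} λ rat → ¬speedable (inj₁ rat)
      in ¬always-slow em irr approx ¬left ¬right λ {f} F → decidable-stable em λ ¬slow →
           ¬speedable (inj₂ (irr , f , F , not-slow⇒liminf {α} irr a f ¬slow))

corollary2p6 : ExcludedMiddle 0ℓ → (α : ℝ) → 0ℝ < α → α < 1ℝ →
    DCE α → ¬ LeftCE α → ¬ RightCE α → FullyDCESpeedable α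
corollary2p6 em α _ _ dce ¬left ¬right = dce , λ a (approx , _) → speedable em a approx ¬left ¬right
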